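{- For all integers $n,s\ge 1$, $\chi_{ltna}(C_{4n+2}\vee O_{2s+1})=3$.
   Context: All graphs are finite and simple. $C_k$ is the cycle on $k$ vertices. $O_m$ is the null (edgeless) graph on $m$ vertices. The join $G\vee H$ of (vertex-disjoint) graphs has $V(G\vee H)=V(G)\cup V(H)$ and $E(G\vee H)=E(G)\cup E(H)\cup\{uv\mid u\in V(G),v\in V(H)\}$. For a graph $G=(V,E)$ of order $p$ and size $q$ without isolated vertices, a bijection $f:V\cup E\to\{1,\dots,p+q\}$ is a local total neighborhood antimagic labeling of $G$ if the induced vertex coloring $f^+_{tn}(u)=\sum_{ux\in E}[f(ux)+f(x)]$ satisfies $f^+_{tn}(u)\ne f^+_{tn}(v)$ for every edge $uv\in E$. The number of distinct induced colors is $c_{tn}(f)$. The local total neighborhood antimagic chromatic number $\chi_{ltna}(G)$ is the minimum of $c_{tn}(f)$ over all local total neighborhood antimagic labelings $f$ of $G$; an assertion $\chi_{ltna}(G)=k$ includes the assertion that $G$ admits such a labeling. -}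

module Defs where

open import Level using (0ℓ)
open import Data.Nat using (ℕ; suc; _+_; _*_; _≤_; z≤n; s≤s)
import Data.Nat as ℕ
open import Data.Nat.Properties
  using (+-0-commutativeMonoid; +-monoˡ-≤; *-monoʳ-≤; ≤-trans; 1+n≢n)
open import Data.Fin using (Fin; toℕ; splitAt; _<?_)
open import Data.List using (length; map; allFin; deduplicate)
open import Data.Product using (_×_; _,_; ∃; ∃-syntax; ∃₂)
open import Data.Sum using (_⊎_; inj₁; inj₂; swap)
open import Data.Sum.Relation.Binary.Pointwise using (_⊎ₛ_)
open import Data.Unit using (⊤; tt)
open import Data.Empty using (⊥)
open import Function.Bundles using (Bijection)
open import Relation.Binary using (Rel; Setoid; Symmetric; Decidable)
open import Relation.Nullary using (¬_; yes; no; _×-dec_; _⊎-dec_)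
open import Relation.Binary.PropositionalEquality as ≡
  using (_≡_; _≢_; refl; sym; trans; cong)
open import Algebra.Properties.CommutativeMonoid.Sum +-0-commutativeMonoid using (sum)

record Graph (p : ℕ) : Set₁ where
  field
    Adj        : Rel (Fin p) 0ℓ
    adj?       : Decidable Adj
    adj-sym    : Symmetric Adj
    adj-irrefl : ∀ u → ¬ Adj u u

open Graph public

NoIsolated : ∀ {p} → Graph p → Set
NoIsolated G = ∀ u → ∃[ v ] Adj G u v

-- An edge is given by an ordered pair of adjacent vertices; (u , v) and
-- (v , u) are the same edge, and the adjacency proof is disregarded.
Edge : ∀ {p} → Graph p → Set
Edge G = ∃₂ λ u v → Adj G u v

SameEdge : ∀ {p} (G : Graph p) → Rel (Edge G) 0ℓ
SameEdge G (u , v , _) (u′ , v′ , _) = (u ≡ u′ × v ≡ v′) ⊎ (u ≡ v′ × v ≡ u′)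

edgeSetoid : ∀ {p} → Graph p → Setoid 0ℓ 0ℓ
edgeSetoid G = record
  { Carrier       = Edge G
  ; _≈_           = SameEdge G
  ; isEquivalence = record
    { refl  = inj₁ (refl , refl)
    ; sym   = λ where
        (inj₁ (refl , refl)) → inj₁ (refl , refl)
        (inj₂ (refl , refl)) → inj₂ (refl , refl)
    ; trans = λ where
        (inj₁ (refl , refl)) e                    → e
        (inj₂ (refl , refl)) (inj₁ (refl , refl)) → inj₂ (refl , refl)
        (inj₂ (refl , refl)) (inj₂ (refl , refl)) → inj₁ (refl , refl)
    }
  }

module _ {p} (G : Graph p) where

  -- Each edge is counted once, at its representative (u , v) with u < v.
  edgeCount : Fin p → Fin p → ℕ
  edgeCount u v with u <? v ×-dec adj? G u v
  ... | yes _ = 1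
  ... | no  _ = 0

  size : ℕ
  size = sum λ u → sum λ v → edgeCount u v

-- Fin (p + size G) stands for {1, …, p + q}: the element i is the label 1 + i.
TotalLabeling : ∀ {p} → Graph p → Set
TotalLabeling {p} G =
  Bijection (≡.setoid (Fin p) ⊎ₛ edgeSetoid G) (≡.setoid (Fin (p + size G)))

module _ {p} (G : Graph p) (f : TotalLabeling G) where

  vertexLabel : Fin p → ℕ
  vertexLabel u = suc (toℕ (Bijection.to f (inj₁ u)))

  edgeLabel : Edge G → ℕ
  edgeLabel e = suc (toℕ (Bijection.to f (inj₂ e)))

  contribution : Fin p → Fin p → ℕ
  contribution u x with adj? G u x
  ... | yes ux = edgeLabel (u , x , ux) + vertexLabel x
  ... | no  _  = 0

  color : Fin p → ℕ
  color u = sum λ x → contribution u x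

  numColors : ℕ
  numColors = length (deduplicate ℕ._≟_ (map color (allFin p)))

  record IsLocalTotalNeighborhoodAntimagic : Set where
    field
      noIsolated : NoIsolated G
      proper     : ∀ u v → Adj G u v → color u ≢ color v

-- χ_ltna is a minimum over a set of labelings that may be empty, so it is
-- given as a relation "χ_ltna(G) = k" rather than as a function of G.
record χltna_≡_ {p} (G : Graph p) (k : ℕ) : Set where
  field
    attained : ∃[ f ] IsLocalTotalNeighborhoodAntimagic G f × numColors G f ≡ k
    minimal  : ∀ f → IsLocalTotalNeighborhoodAntimagic G f → k ≤ numColors G f

infix 4 χltna_≡_

O : ∀ m → Graph m
O m = record
  { Adj        = λ _ _ → ⊥
  ; adj?       = λ _ _ → no λ ()
  ; adj-sym    = λ ()
  ; adj-irrefl = λ _ ()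
  }

-- The cyclic successor on {0, …, k - 1}.
Next : ∀ {k} → Rel (Fin k) 0ℓ
Next {k} i j = toℕ j ≡ suc (toℕ i) ⊎ (suc (toℕ i) ≡ k × toℕ j ≡ 0)

next? : ∀ {k} → Decidable (Next {k})
next? {k} i j =
  (toℕ j ℕ.≟ suc (toℕ i)) ⊎-dec ((suc (toℕ i) ℕ.≟ k) ×-dec (toℕ j ℕ.≟ 0))

next-irrefl : ∀ {k} → 3 ≤ k → (i : Fin k) → ¬ Next i i
next-irrefl _   i (inj₁ e) = 1+n≢n (sym e)
next-irrefl 3≤k i (inj₂ (e , z)) with trans (sym e) (cong suc z)
next-irrefl (s≤s ()) i (inj₂ _) | refl

C : ∀ k → 3 ≤ k → Graph k
C k 3≤k = record
  { Adj        = λ i j → Next i j ⊎ Next j i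
  ; adj?       = λ i j → next? i j ⊎-dec next? j i
  ; adj-sym    = swap
  ; adj-irrefl = λ where
      i (inj₁ e) → next-irrefl 3≤k i e
      i (inj₂ e) → next-irrefl 3≤k i e
  }

module _ {m n} (G : Graph m) (H : Graph n) where

  JoinAdj : Rel (Fin m ⊎ Fin n) 0ℓ
  JoinAdj (inj₁ u) (inj₁ v) = Adj G u v
  JoinAdj (inj₁ _) (inj₂ _) = ⊤
  JoinAdj (inj₂ _) (inj₁ _) = ⊤
  JoinAdj (inj₂ u) (inj₂ v) = Adj H u v

  joinAdj? : Decidable JoinAdj
  joinAdj? (inj₁ u) (inj₁ v) = adj? G u v
  joinAdj? (inj₁ _) (inj₂ _) = yes tt
  joinAdj? (inj₂ _) (inj₁ _) = yes tt
  joinAdj? (inj₂ u) (inj₂ v) = adj? H u v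

  joinAdj-sym : ∀ x y → JoinAdj x y → JoinAdj y x
  joinAdj-sym (inj₁ _) (inj₁ _) e = adj-sym G e
  joinAdj-sym (inj₁ _) (inj₂ _) _ = tt
  joinAdj-sym (inj₂ _) (inj₁ _) _ = tt
  joinAdj-sym (inj₂ _) (inj₂ _) e = adj-sym H e

  joinAdj-irrefl : ∀ x → ¬ JoinAdj x x
  joinAdj-irrefl (inj₁ u) = adj-irrefl G u
  joinAdj-irrefl (inj₂ u) = adj-irrefl H u

  -- The first m vertices are those of G, the last n those of H.
  infixr 6 _∨_
  _∨_ : Graph (m + n)
  _∨_ = record
    { Adj        = λ u v → JoinAdj (splitAt m u) (splitAt m v)
    ; adj?       = λ u v → joinAdj? (splitAt m u) (splitAt m v)
    ; adj-sym    = λ {u} {v} → joinAdj-sym (splitAt m u) (splitAt m v)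
    ; adj-irrefl = λ u → joinAdj-irrefl (splitAt m u)
    }

3≤4n+2 : ∀ {n} → 1 ≤ n → 3 ≤ 4 * n + 2
3≤4n+2 {n} 1≤n =
  ≤-trans (s≤s (s≤s (s≤s z≤n))) (+-monoˡ-≤ 2 (*-monoʳ-≤ 4 1≤n))

{-# OPTIONS --safe #-}

-- Write m = 4n + 2 = 2h with h = 2n + 1, t = 2s + 1, and let μ be the middle label.
-- A label is written μ + z with a centred value z, |z| ≤ K = μ − 1. Let σᵢ = (−1)ⁱ and
-- let κᵢ be i/2 modulo h. For the cycle vertices xᵢ, the cycle edges xᵢxᵢ₊₁, and the
-- spokes to the first null vertex w₀ take the values
--   σᵢ (1 + κᵢ),   −σᵢ (2h + 1 + κᵢ),   σᵢ (h + 1 + (i + 1 mod h)),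
-- and give w₀ the value 0. As h is odd, these are exactly the values of modulus ≤ 3h,
-- and κᵢ + κᵢ₊₁ = n + (i + 1 mod h) makes the sum of the values around xᵢ equal to σᵢ n.
-- The other null vertices come in pairs labelled by opposite values: each pair uses a
-- block ±{c, …, c + m} of moduli, with c + 3 on the two vertices and the others on the
-- spokes, signed so that they sum to 0 over the cycle. The colors are then Λ ± n on the
-- cycle and 2mμ on the null vertices, where Λ = (2t + 4)μ; they are distinct because
-- 0 < n < μ. Conversely, a triangle already needs three colors.
module Submission where

open import Defs
open import Data.Nat
open import Data.Nat.Properties
open import Data.Nat.DivMod
import Data.Nat as ℕ
import Data.Nat.Tactic.RingSolver as ℕ-Solver
open import Agda.Builtin.Int using (pos)
open import Data.Integer as ℤ using (ℤ; -_; 0ℤ; 1ℤ; -1ℤ; ∣_∣; -[1+_])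
import Data.Integer.Properties as ℤ
import Data.Integer.Tactic.RingSolver as ℤ-Solver
open import Data.Fin as Fin using (Fin; toℕ; fromℕ<; splitAt; _↑ˡ_; _↑ʳ_; cast)
import Data.Fin.Properties as Fin
open import Data.Product using (_×_; _,_; ∃-syntax; proj₁; proj₂)
open import Data.Sum using (_⊎_; inj₁; inj₂)
open import Data.Sum.Properties using (inj₁-injective; inj₂-injective)
open import Data.Sum.Function.Propositional using (_⊎-↔_)
import Data.Sum.Relation.Binary.Pointwise as ⊎
open import Data.Unit using (tt)
open import Data.List using (List; []; _∷_; map; allFin; length; lookup; deduplicate)
open import Data.List.Membership.Propositional using (_∈_)
open import Data.List.Membership.Propositional.Properties
  using (∈-lookup; ∈-map⁺; ∈-map⁻; ∈-allFin; ∈-deduplicate⁺; ∈-deduplicate⁻)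
open import Data.List.Relation.Unary.Any using (here; there; index)
open import Data.List.Relation.Unary.Any.Properties using (lookup-index)
open import Data.List.Relation.Unary.All as All using ([]; _∷_)
open import Data.List.Relation.Unary.AllPairs using ([]; _∷_)
open import Data.List.Relation.Unary.Unique.Propositional using (Unique)
open import Data.List.Relation.Unary.Unique.DecPropositional.Properties ℕ._≟_ using (deduplicate-!)
open import Data.List.Relation.Binary.Subset.Propositional using (_⊆_)
open import Function using (_∘_; Injective)
open import Function.Bundles using (Bijection; Inverse; _↔_)
open import Function.Properties.Inverse using (↔-refl; ↔-trans)
open import Relation.Nullary using (¬_; Dec; yes; no; contradiction; _×-dec_)
open import Relation.Binary.PropositionalEquality
open import Algebra.Properties.CommutativeMonoid.Sum +-0-commutativeMonoid
  using (sum; sum-cong-≗; ∑-distrib-+; sum-replicate-zero)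

-- Counting the distinct entries of a list.

lookup-injective : ∀ {A : Set} {xs : List A} → Unique xs → Injective _≡_ _≡_ (lookup xs)
lookup-injective (_  ∷ _)   {Fin.zero}  {Fin.zero}  _  = refl
lookup-injective (x≢ ∷ _)   {Fin.zero}  {Fin.suc j} eq = contradiction eq (All.lookup x≢ (∈-lookup j))
lookup-injective (x≢ ∷ _)   {Fin.suc i} {Fin.zero}  eq = contradiction (sym eq) (All.lookup x≢ (∈-lookup i))
lookup-injective (_  ∷ xs!) {Fin.suc i} {Fin.suc j} eq = cong Fin.suc (lookup-injective xs! eq)

-- Each index of `xs` goes to a position of the same element in `ys`. Reading that position back
-- recovers the element, so the map is injective and the pigeonhole principle compares the lengths.
Unique-⊆⇒length≤ : ∀ {A : Set} {xs ys : List A} → Unique xs → xs ⊆ ys → length xs ≤ length ys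
Unique-⊆⇒length≤ {xs = xs} {ys} xs! xs⊆ys = Fin.injective⇒≤ {f = position} position-injective
  where
  position : Fin (length xs) → Fin (length ys)
  position i = index (xs⊆ys (∈-lookup i))
  position-injective : Injective _≡_ _≡_ position
  position-injective {i} {j} eq = lookup-injective xs!
    (trans (lookup-index (xs⊆ys (∈-lookup i)))
      (trans (cong (lookup ys) eq) (sym (lookup-index (xs⊆ys (∈-lookup j))))))

length-deduplicate≥ : ∀ {xs ys : List ℕ} → Unique xs → xs ⊆ ys → length xs ≤ length (deduplicate ℕ._≟_ ys)
length-deduplicate≥ xs! xs⊆ys = Unique-⊆⇒length≤ xs! (∈-deduplicate⁺ ℕ._≟_ ∘ xs⊆ys)

length-deduplicate : ∀ {xs ys : List ℕ} → Unique xs → xs ⊆ ys → ys ⊆ xs → length (deduplicate ℕ._≟_ ys) ≡ length xs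
length-deduplicate {ys = ys} xs! xs⊆ys ys⊆xs =
  ≤-antisym (Unique-⊆⇒length≤ (deduplicate-! ys) (ys⊆xs ∘ ∈-deduplicate⁻ ℕ._≟_ ys))
            (length-deduplicate≥ xs! xs⊆ys)

-- Surjections between finite sets of equal size.

-- A collision leaves a point outside the image of a section of `f`; adjoining that point to the
-- section would inject `Fin (suc n)` into `Fin n`.
surjective⇒injective : ∀ {n} (f : Fin n → Fin n) → (∀ y → ∃[ x ] f x ≡ y) → Injective _≡_ _≡_ f
surjective⇒injective {n} f onto {x} {y} fx≡fy with x Fin.≟ y
... | yes x≡y = x≡y
... | no x≢y  = contradiction (Fin.injective⇒≤ {f = extended} (λ {i} {j} → extended-injective i j)) 1+n≰n
  where
  section : Fin n → Fin n
  section z = proj₁ (onto z)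

  section-injective : Injective _≡_ _≡_ section
  section-injective {i} {j} eq = trans (sym (proj₂ (onto i))) (trans (cong f eq) (proj₂ (onto j)))

  -- One of x and y is missed by the section, since both lie over f x.
  missed : ∃[ w ] ∀ z → section z ≢ w
  missed with section (f x) Fin.≟ x
  ... | yes eq = y , λ z e → x≢y (trans (sym eq)
        (trans (cong section (trans fx≡fy (trans (cong f (sym e)) (proj₂ (onto z))))) e))
  ... | no neq = x , λ z e → neq (trans (cong section (trans (cong f (sym e)) (proj₂ (onto z)))) e)

  extended : Fin (suc n) → Fin n
  extended Fin.zero    = proj₁ missed
  extended (Fin.suc i) = section i

  extended-injective : ∀ i j → extended i ≡ extended j → i ≡ j
  extended-injective Fin.zero    Fin.zero    _  = refl
  extended-injective Fin.zero    (Fin.suc j) eq = contradiction (sym eq) (proj₂ missed j)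
  extended-injective (Fin.suc i) Fin.zero    eq = contradiction eq (proj₂ missed i)
  extended-injective (Fin.suc i) (Fin.suc j) eq = cong Fin.suc (section-injective eq)

-- Spares a direct injectivity proof for the labeling: it is enough that every label is used.
↔-surjective⇒injective : ∀ {A : Set} {n} → Fin n ↔ A → (f : A → Fin n) →
                         (∀ y → ∃[ x ] f x ≡ y) → Injective _≡_ _≡_ f
↔-surjective⇒injective A↔ f onto {a} {b} eq =
  trans (sym (A.strictlyInverseˡ a)) (trans (cong A.to
    (surjective⇒injective (f ∘ A.to)
      (λ y → A.from (proj₁ (onto y)) , trans (cong f (A.strictlyInverseˡ _)) (proj₂ (onto y)))
      (trans (cong f (A.strictlyInverseˡ a)) (trans eq (cong f (sym (A.strictlyInverseˡ b)))))))
    (A.strictlyInverseˡ b))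
  where module A = Inverse A↔

-- Triangles and the number of colors.

Unique-triple : ∀ {a b c : ℕ} → a ≢ b → a ≢ c → b ≢ c → Unique (a ∷ b ∷ c ∷ [])
Unique-triple a≢b a≢c b≢c = (a≢b ∷ a≢c ∷ []) ∷ (b≢c ∷ []) ∷ [] ∷ []

module _ {p} {G : Graph p} {f : TotalLabeling G} (lab : IsLocalTotalNeighborhoodAntimagic G f)
         {u v w} (uv : Adj G u v) (uw : Adj G u w) (vw : Adj G v w) where

  private
    colors : List ℕ
    colors = color G f u ∷ color G f v ∷ color G f w ∷ []

    colors! : Unique colors
    colors! = Unique-triple (proper u v uv) (proper u w uw) (proper v w vw)
      where open IsLocalTotalNeighborhoodAntimagic lab

    color-∈ : ∀ x → color G f x ∈ map (color G f) (allFin p)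
    color-∈ x = ∈-map⁺ (color G f) (∈-allFin x)

    colors⊆ : colors ⊆ map (color G f) (allFin p)
    colors⊆ (here refl)                 = color-∈ u
    colors⊆ (there (here refl))         = color-∈ v
    colors⊆ (there (there (here refl))) = color-∈ w

  triangle⇒3≤numColors : 3 ≤ numColors G f
  triangle⇒3≤numColors = length-deduplicate≥ colors! colors⊆

  triangle⇒numColors≡3 : (∀ x → color G f x ≡ color G f u ⊎ color G f x ≡ color G f v ⊎ color G f x ≡ color G f w) →
                         numColors G f ≡ 3
  triangle⇒numColors≡3 cover = length-deduplicate colors! colors⊆ ⊆colors
    where
    ⊆colors : map (color G f) (allFin p) ⊆ colors
    ⊆colors c∈ with (x , _ , refl) ← ∈-map⁻ (color G f) c∈ with cover x
    ... | inj₁ eq        = here eq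
    ... | inj₂ (inj₁ eq) = there (here eq)
    ... | inj₂ (inj₂ eq) = there (there (here eq))

-- Finite sums, edge counts and contributions.

sum-zero : ∀ {n} (f : Fin n → ℕ) → (∀ x → f x ≡ 0) → sum f ≡ 0
sum-zero {n} f f≡0 = trans (sum-cong-≗ f≡0) (sum-replicate-zero n)

sum-const : ∀ n c → sum {n} (λ _ → c) ≡ n * c
sum-const zero    c = refl
sum-const (suc n) c = cong (c +_) (sum-const n c)

sum-single : ∀ {n} (f : Fin n → ℕ) a → (∀ x → x ≢ a → f x ≡ 0) → sum f ≡ f a
sum-single f Fin.zero    f≡0 = trans (cong (f Fin.zero +_) (sum-zero (f ∘ Fin.suc) λ x → f≡0 (Fin.suc x) λ ()))
                                 (+-identityʳ (f Fin.zero))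
sum-single f (Fin.suc a) f≡0 = trans (cong (_+ sum (f ∘ Fin.suc)) (f≡0 Fin.zero λ ()))
  (sum-single (f ∘ Fin.suc) a λ x x≢a → f≡0 (Fin.suc x) (x≢a ∘ Fin.suc-injective))

sum-pair : ∀ {n} (f : Fin n → ℕ) {a b} → a ≢ b → (∀ x → x ≢ a → x ≢ b → f x ≡ 0) → sum f ≡ f a + f b
sum-pair f {Fin.zero}  {Fin.zero}  a≢b f≡0 = contradiction refl a≢b
sum-pair f {Fin.zero}  {Fin.suc b} a≢b f≡0 = cong (f Fin.zero +_)
  (sum-single (f ∘ Fin.suc) b λ x x≢b → f≡0 (Fin.suc x) (λ ()) (x≢b ∘ Fin.suc-injective))
sum-pair f {Fin.suc a} {Fin.zero}  a≢b f≡0 = trans (cong (f Fin.zero +_)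
  (sum-single (f ∘ Fin.suc) a λ x x≢a → f≡0 (Fin.suc x) (x≢a ∘ Fin.suc-injective) (λ ())))
  (+-comm (f Fin.zero) (f (Fin.suc a)))
sum-pair f {Fin.suc a} {Fin.suc b} a≢b f≡0 = trans (cong (_+ sum (f ∘ Fin.suc)) (f≡0 Fin.zero (λ ()) (λ ())))
  (sum-pair (f ∘ Fin.suc) (a≢b ∘ cong Fin.suc)
    λ x x≢a x≢b → f≡0 (Fin.suc x) (x≢a ∘ Fin.suc-injective) (x≢b ∘ Fin.suc-injective))

sum-splitAt : ∀ m {n} (f : Fin (m + n) → ℕ) → sum f ≡ sum (f ∘ (_↑ˡ n)) + sum (f ∘ (m ↑ʳ_))
sum-splitAt zero    f = refl
sum-splitAt (suc m) f = trans (cong (f Fin.zero +_) (sum-splitAt m (f ∘ Fin.suc))) (sym (+-assoc (f Fin.zero) _ _))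

indicator : ∀ {P : Set} → Dec P → ℕ
indicator (yes _) = 1
indicator (no _)  = 0

indicator-yes : ∀ {P : Set} (P? : Dec P) → P → indicator P? ≡ 1
indicator-yes (yes _) _ = refl
indicator-yes (no ¬p) p = contradiction p ¬p

indicator-no : ∀ {P : Set} (P? : Dec P) → ¬ P → indicator P? ≡ 0
indicator-no (yes p) ¬p = contradiction p ¬p
indicator-no (no _)  _  = refl

module _ {p} (G : Graph p) where

  edgeCount-yes : ∀ {u v} → u Fin.< v → Adj G u v → edgeCount G u v ≡ 1
  edgeCount-yes {u} {v} u<v uv with u Fin.<? v ×-dec adj? G u v
  ... | yes _ = refl
  ... | no ¬e = contradiction (u<v , uv) ¬e

  edgeCount-no : ∀ {u v} → ¬ (u Fin.< v × Adj G u v) → edgeCount G u v ≡ 0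
  edgeCount-no {u} {v} ¬e with u Fin.<? v ×-dec adj? G u v
  ... | yes e = contradiction e ¬e
  ... | no _  = refl

  module _ (f : TotalLabeling G) where

    -- The adjacency proof found by `adj?` may differ from `ux`, but `SameEdge` disregards it and
    -- `f` respects `SameEdge`.
    contribution-adjacent : ∀ {u x} (ux : Adj G u x) →
      contribution G f u x ≡ edgeLabel G f (u , x , ux) + vertexLabel G f x
    contribution-adjacent {u} {x} ux with adj? G u x
    ... | yes ux′ = cong (λ l → suc (toℕ l) + vertexLabel G f x)
                      (Bijection.cong f {inj₂ (u , x , ux′)} {inj₂ (u , x , ux)} (⊎.inj₂ (inj₁ (refl , refl))))
    ... | no ¬ux  = contradiction ux ¬ux

    contribution-nonadjacent : ∀ {u x} → ¬ Adj G u x → contribution G f u x ≡ 0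
    contribution-nonadjacent {u} {x} ¬ux with adj? G u x
    ... | yes ux = contradiction ux ¬ux
    ... | no _   = refl

-- The cyclic successor.

toℕ≢n : ∀ {n} (i : Fin n) → toℕ i ≢ n
toℕ≢n i = <⇒≢ (Fin.toℕ<n i)

module _ {m : ℕ} where

  Next-functional : {i j j′ : Fin m} → Next i j → Next i j′ → j ≡ j′
  Next-functional (inj₁ p)       (inj₁ q)       = Fin.toℕ-injective (trans p (sym q))
  Next-functional (inj₁ p)       (inj₂ (e , _)) = contradiction (trans p e) (toℕ≢n _)
  Next-functional (inj₂ (e , _)) (inj₁ q)       = contradiction (trans q e) (toℕ≢n _)
  Next-functional (inj₂ (_ , p)) (inj₂ (_ , q)) = Fin.toℕ-injective (trans p (sym q))

  Next-injective : {i i′ j : Fin m} → Next i j → Next i′ j → i ≡ i′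
  Next-injective (inj₁ p)       (inj₁ q)       = Fin.toℕ-injective (suc-injective (trans (sym p) q))
  Next-injective (inj₁ p)       (inj₂ (_ , z)) = contradiction (trans (sym p) z) λ ()
  Next-injective (inj₂ (_ , z)) (inj₁ q)       = contradiction (trans (sym q) z) λ ()
  Next-injective (inj₂ (p , _)) (inj₂ (q , _)) = Fin.toℕ-injective (suc-injective (trans p (sym q)))

  next-exists : (i : Fin m) → ∃[ j ] Next i j
  next-exists i with suc (toℕ i) <? m
  ... | yes i+1<m = fromℕ< i+1<m , inj₁ (Fin.toℕ-fromℕ< i+1<m)
  ... | no i+1≮m  = fromℕ< 0<m , inj₂ (≤-antisym (Fin.toℕ<n i) (≮⇒≥ i+1≮m) , Fin.toℕ-fromℕ< 0<m)
    where 0<m = <-≤-trans (s≤s z≤n) (Fin.toℕ<n i)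

prev-exists : ∀ {m} (j : Fin m) → ∃[ i ] Next i j
prev-exists Fin.zero    = Fin.fromℕ _ , inj₂ (cong suc (Fin.toℕ-fromℕ _) , refl)
prev-exists (Fin.suc j) = Fin.inject₁ j , inj₁ (cong suc (sym (Fin.toℕ-inject₁ j)))

-- Without a wrap-around the index would grow by two and return to itself; one wrap-around forces
-- `m` to be 2, and two force it to be 1. Hence a cycle edge has only one direction, on which its
-- code relies.
Next-asym : ∀ {m} → 3 ≤ m → {i j : Fin m} → Next i j → ¬ Next j i
Next-asym 3≤m (inj₁ p)       (inj₁ q)       = m≢1+m+n _ (trans (trans q (cong suc p)) (cong suc (+-comm 1 _)))
Next-asym 3≤m (inj₁ p)       (inj₂ (e , z)) =
  contradiction (subst (3 ≤_) (trans (sym e) (cong suc (trans p (cong suc z)))) 3≤m) (n≮n 2)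
Next-asym 3≤m (inj₂ (e , z)) (inj₁ q)       =
  contradiction (subst (3 ≤_) (trans (sym e) (cong suc (trans q (cong suc z)))) 3≤m) (n≮n 2)
Next-asym 3≤m (inj₂ (e , z)) (inj₂ (e′ , z′)) =
  contradiction (subst (3 ≤_) (trans (sym e) (cong suc z′)) 3≤m) λ { (s≤s ()) }

-- Adjacency and size of the join of a cycle and a null graph.

module CycleJoin (m t : ℕ) (3≤m : 3 ≤ m) where

  G : Graph (m + t)
  G = C m 3≤m ∨ O t

  Cyc : Fin m → Fin m → Set
  Cyc = Adj (C m 3≤m)

  next prev : Fin m → Fin m
  next i = proj₁ (next-exists i)
  prev i = proj₁ (prev-exists i)

  next≢prev : ∀ i → next i ≢ prev i
  next≢prev i eq = Next-asym 3≤m (proj₂ (next-exists i)) (subst (λ j → Next j i) (sym eq) (proj₂ (prev-exists i)))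

  nonadjacent : ∀ {i x} → x ≢ next i → x ≢ prev i → ¬ Cyc i x
  nonadjacent {i} x≢next _      (inj₁ ix) = x≢next (Next-functional ix (proj₂ (next-exists i)))
  nonadjacent {i} _      x≢prev (inj₂ xi) = x≢prev (Next-injective xi (proj₂ (prev-exists i)))

  private
    ▸ : Fin m → Fin (m + t)
    ▸ i = i ↑ˡ t
    ◂ : Fin t → Fin (m + t)
    ◂ j = m ↑ʳ j

  -- Adjacency in the join computes only after `splitAt` does, so the sides of `u` and `v` are
  -- passed as equations and matched with `refl`.
  Adj⁺ : ∀ {x y : Fin m ⊎ Fin t} {u v} → splitAt m u ≡ x → splitAt m v ≡ y →
         JoinAdj (C m 3≤m) (O t) x y → Adj G u v
  Adj⁺ refl refl e = e

  Adj⁻ : ∀ {x y : Fin m ⊎ Fin t} {u v} → splitAt m u ≡ x → splitAt m v ≡ y →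
         Adj G u v → JoinAdj (C m 3≤m) (O t) x y
  Adj⁻ refl refl e = e

  at-cycle : ∀ i → splitAt m (▸ i) ≡ inj₁ i
  at-cycle i = Fin.splitAt-↑ˡ m i t

  at-null : ∀ j → splitAt m (◂ j) ≡ inj₂ j
  at-null j = Fin.splitAt-↑ʳ m t j

  cycle-edge : ∀ {i i′} → Cyc i i′ → Adj G (▸ i) (▸ i′)
  cycle-edge = Adj⁺ (at-cycle _) (at-cycle _)

  spoke : ∀ i j → Adj G (▸ i) (◂ j)
  spoke i j = Adj⁺ (at-cycle i) (at-null j) tt

  ▸<▸ : ∀ {i i′} → ▸ i Fin.< ▸ i′ → i Fin.< i′
  ▸<▸ {i} {i′} = subst₂ _<_ (Fin.toℕ-↑ˡ i t) (Fin.toℕ-↑ˡ i′ t)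

  ▸<▸⁺ : ∀ {i i′} → i Fin.< i′ → ▸ i Fin.< ▸ i′
  ▸<▸⁺ {i} {i′} = subst₂ _<_ (sym (Fin.toℕ-↑ˡ i t)) (sym (Fin.toℕ-↑ˡ i′ t))

  ▸<◂ : ∀ i j → ▸ i Fin.< ◂ j
  ▸<◂ i j = subst₂ _<_ (sym (Fin.toℕ-↑ˡ i t)) (sym (Fin.toℕ-↑ʳ m j))
              (<-≤-trans (Fin.toℕ<n i) (m≤m+n m (toℕ j)))

  first? : (i : Fin m) → Dec (toℕ i ≡ 0)
  first? i = toℕ i ≟ 0

  last? : (i : Fin m) → Dec (suc (toℕ i) ≡ m)
  last? i = suc (toℕ i) ≟ m

  forward : Fin m → ℕ
  forward i = sum λ i′ → edgeCount G (▸ i) (▸ i′)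

  -- Every cycle vertex i sees one larger neighbour, i + 1, except that the
  -- first vertex sees the last one as well and the last vertex sees none.
  forward-count : ∀ i → forward i + indicator (last? i) ≡ 1 + indicator (first? i)
  forward-count i with proj₂ (next-exists i) | proj₂ (prev-exists i)
  ... | inj₂ (e , z) | inj₂ (e′ , z′) =
    -- A vertex that is both first and last would make `m` equal to 1.
    contradiction (subst (3 ≤_) (trans (sym e) (cong suc z′)) 3≤m) λ { (s≤s ()) }
  ... | inj₁ i→n | inj₁ p→i = begin
    forward i + indicator (last? i)  ≡⟨ cong₂ _+_ forward≡1 (indicator-no (last? i) λ e → toℕ≢n _ (trans i→n e)) ⟩
    1 + 0                            ≡⟨ cong suc (indicator-no (first? i) λ z → contradiction (trans (sym p→i) z) λ ()) ⟨
    1 + indicator (first? i)         ∎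
    where
    open ≡-Reasoning
    forward≡1 : forward i ≡ 1
    forward≡1 = trans
      (sum-single _ (next i) λ x x≢next → edgeCount-no G λ (i<x , ix) → nonadjacent x≢next
        (λ { refl → contradiction (▸<▸ i<x) (<⇒≯ (≤-reflexive (sym p→i))) })
        (Adj⁻ (at-cycle i) (at-cycle x) ix))
      (edgeCount-yes G (▸<▸⁺ (≤-reflexive (sym i→n))) (cycle-edge (inj₁ (inj₁ i→n))))
  ... | inj₁ i→n | inj₂ (e , z) = begin
    forward i + indicator (last? i)  ≡⟨ cong₂ _+_ forward≡2 (indicator-no (last? i) λ e → toℕ≢n _ (trans i→n e)) ⟩
    1 + 1                            ≡⟨ cong suc (indicator-yes (first? i) z) ⟨
    1 + indicator (first? i)         ∎
    where
    open ≡-Reasoning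
    i<prev : i Fin.< prev i
    i<prev = subst (_< toℕ (prev i)) (sym z)
      (≤-trans (s≤s z≤n) (≤-pred (subst (3 ≤_) (sym e) 3≤m)))
    forward≡2 : forward i ≡ 2
    forward≡2 = trans
      (sum-pair _ (next≢prev i) λ x x≢next x≢prev → edgeCount-no G λ (_ , ix) →
        nonadjacent x≢next x≢prev (Adj⁻ (at-cycle i) (at-cycle x) ix))
      (cong₂ _+_
        (edgeCount-yes G (▸<▸⁺ (≤-reflexive (sym i→n))) (cycle-edge (inj₁ (inj₁ i→n))))
        (edgeCount-yes G (▸<▸⁺ i<prev) (cycle-edge (inj₂ (inj₂ (e , z))))))
  ... | inj₂ (e , z) | inj₁ p→i = begin
    forward i + indicator (last? i)  ≡⟨ cong₂ _+_ forward≡0 (indicator-yes (last? i) e) ⟩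
    1                                ≡⟨ cong suc (indicator-no (first? i) λ z → contradiction (trans (sym p→i) z) λ ()) ⟨
    1 + indicator (first? i)         ∎
    where
    open ≡-Reasoning
    forward≡0 : forward i ≡ 0
    forward≡0 = sum-zero _ λ x → edgeCount-no G λ (i<x , _) →
      <⇒≱ (Fin.toℕ<n x) (subst (_≤ toℕ x) e (▸<▸ i<x))

  -- Edges are counted at their smaller end. A null vertex has no larger neighbour, and a cycle
  -- vertex has `t` larger null neighbours besides those counted by `forward`.
  size≡ : size G ≡ m + m * t
  size≡ = begin
    size G
      ≡⟨ sum-splitAt m _ ⟩
    sum (λ i → sum (edgeCount G (▸ i))) + sum (λ j → sum (edgeCount G (◂ j)))
      ≡⟨ cong₂ _+_ (sum-cong-≗ from-cycle) (sum-zero _ from-null) ⟩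
    sum (λ i → forward i + t) + 0
      ≡⟨ +-identityʳ _ ⟩
    sum (λ i → forward i + t)
      ≡⟨ ∑-distrib-+ forward (λ _ → t) ⟩
    sum forward + sum (λ (_ : Fin m) → t)
      ≡⟨ cong₂ _+_ sum-forward (sum-const m t) ⟩
    m + m * t ∎
    where
    open ≡-Reasoning

    from-cycle : ∀ i → sum (edgeCount G (▸ i)) ≡ forward i + t
    from-cycle i = trans (sum-splitAt m _) (cong (forward i +_)
      (trans (sum-cong-≗ λ j → edgeCount-yes G (▸<◂ i j) (spoke i j))
             (trans (sum-const t 1) (*-identityʳ t))))

    from-null : ∀ j → sum (edgeCount G (◂ j)) ≡ 0
    from-null j = trans (sum-splitAt m _) (cong₂ _+_
      (sum-zero _ λ i → edgeCount-no G λ (j<i , _) → <⇒≯ j<i (▸<◂ i j))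
      (sum-zero _ λ j′ → edgeCount-no G λ (_ , e) → Adj⁻ (at-null j) (at-null j′) e))

    first-vertex : ∃[ i ] toℕ i ≡ 0
    first-vertex = fromℕ< 0<m , Fin.toℕ-fromℕ< 0<m
      where 0<m = <-≤-trans (s≤s z≤n) 3≤m

    sum-first : sum (λ i → indicator (first? i)) ≡ 1
    sum-first with (a , a≡0) ← first-vertex = trans
      (sum-single _ a λ x x≢a → indicator-no (first? x) λ z → x≢a (Fin.toℕ-injective (trans z (sym a≡0))))
      (indicator-yes (first? a) a≡0)

    last-vertex : ∃[ i ] suc (toℕ i) ≡ m
    last-vertex with (a , a≡0) ← first-vertex with prev-exists a
    ... | b , inj₁ e       = contradiction (trans (sym a≡0) e) λ ()
    ... | b , inj₂ (e , _) = b , e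

    sum-last : sum (λ i → indicator (last? i)) ≡ 1
    sum-last with (b , e) ← last-vertex = trans
      (sum-single _ b λ x x≢b → indicator-no (last? x) λ e′ →
        x≢b (Fin.toℕ-injective (suc-injective (trans e′ (sym e)))))
      (indicator-yes (last? b) e)

    sum-forward : sum forward ≡ m
    -- Each indicator sums to 1, so the missing edge at the last vertex is made up by the extra one
    -- at the first.
    sum-forward = +-cancelʳ-≡ 1 _ _ (begin
      sum forward + 1                                      ≡⟨ cong (sum forward +_) sum-last ⟨
      sum forward + sum (λ i → indicator (last? i))        ≡⟨ ∑-distrib-+ forward (λ i → indicator (last? i)) ⟨
      sum (λ i → forward i + indicator (last? i))          ≡⟨ sum-cong-≗ forward-count ⟩
      sum (λ i → 1 + indicator (first? i))                 ≡⟨ ∑-distrib-+ (λ _ → 1) (λ i → indicator (first? i)) ⟩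
      sum (λ (_ : Fin m) → 1) + sum (λ i → indicator (first? i))
        ≡⟨ cong₂ _+_ (trans (sum-const m 1) (*-identityʳ m)) sum-first ⟩
      m + 1 ∎)

  -- An edge of the join is either the edge from i to next i on the cycle, or a spoke.
  EdgeCode : Set
  EdgeCode = Fin m ⊎ (Fin m × Fin t)

  edgeCode : ∀ x y → JoinAdj (C m 3≤m) (O t) x y → EdgeCode
  edgeCode (inj₁ i) (inj₁ i′) (inj₁ _) = inj₁ i
  edgeCode (inj₁ i) (inj₁ i′) (inj₂ _) = inj₁ i′
  edgeCode (inj₁ i) (inj₂ j)  _        = inj₂ (i , j)
  edgeCode (inj₂ j) (inj₁ i)  _        = inj₂ (i , j)

  edgeCode-irrelevant : ∀ x y e e′ → edgeCode x y e ≡ edgeCode x y e′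
  edgeCode-irrelevant (inj₁ i) (inj₁ i′) (inj₁ _) (inj₁ _) = refl
  edgeCode-irrelevant (inj₁ i) (inj₁ i′) (inj₁ p) (inj₂ q) = contradiction q (Next-asym 3≤m p)
  edgeCode-irrelevant (inj₁ i) (inj₁ i′) (inj₂ p) (inj₁ q) = contradiction q (Next-asym 3≤m p)
  edgeCode-irrelevant (inj₁ i) (inj₁ i′) (inj₂ _) (inj₂ _) = refl
  edgeCode-irrelevant (inj₁ i) (inj₂ j)  _ _ = refl
  edgeCode-irrelevant (inj₂ j) (inj₁ i)  _ _ = refl

  edgeCode-swap : ∀ x y e e′ → edgeCode x y e ≡ edgeCode y x e′
  edgeCode-swap (inj₁ i) (inj₁ i′) (inj₁ p) (inj₁ q) = contradiction q (Next-asym 3≤m p)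
  edgeCode-swap (inj₁ i) (inj₁ i′) (inj₁ _) (inj₂ _) = refl
  edgeCode-swap (inj₁ i) (inj₁ i′) (inj₂ _) (inj₁ _) = refl
  edgeCode-swap (inj₁ i) (inj₁ i′) (inj₂ p) (inj₂ q) = contradiction q (Next-asym 3≤m p)
  edgeCode-swap (inj₁ i) (inj₂ j)  _ _ = refl
  edgeCode-swap (inj₂ j) (inj₁ i)  _ _ = refl

  -- A cycle edge is coded by its start, and `Next-functional` recovers its end. The directions of
  -- the two adjacencies decide whether the pairs agree or are swapped.
  edgeCode-injective : ∀ x y x′ y′ e e′ → edgeCode x y e ≡ edgeCode x′ y′ e′ →
                       (x ≡ x′ × y ≡ y′) ⊎ (x ≡ y′ × y ≡ x′)
  edgeCode-injective (inj₁ _) (inj₁ _) (inj₁ _) (inj₁ _) (inj₁ p) (inj₁ q) refl =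
    inj₁ (refl , cong inj₁ (Next-functional p q))
  edgeCode-injective (inj₁ _) (inj₁ _) (inj₁ _) (inj₁ _) (inj₁ p) (inj₂ q) refl =
    inj₂ (refl , cong inj₁ (Next-functional p q))
  edgeCode-injective (inj₁ _) (inj₁ _) (inj₁ _) (inj₁ _) (inj₂ p) (inj₁ q) refl =
    inj₂ (cong inj₁ (Next-functional p q) , refl)
  edgeCode-injective (inj₁ _) (inj₁ _) (inj₁ _) (inj₁ _) (inj₂ p) (inj₂ q) refl =
    inj₁ (cong inj₁ (Next-functional p q) , refl)
  edgeCode-injective (inj₁ _) (inj₁ _) (inj₁ _) (inj₂ _) (inj₁ _) _ ()
  edgeCode-injective (inj₁ _) (inj₁ _) (inj₁ _) (inj₂ _) (inj₂ _) _ ()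
  edgeCode-injective (inj₁ _) (inj₁ _) (inj₂ _) (inj₁ _) (inj₁ _) _ ()
  edgeCode-injective (inj₁ _) (inj₁ _) (inj₂ _) (inj₁ _) (inj₂ _) _ ()
  edgeCode-injective (inj₁ _) (inj₂ _) (inj₁ _) (inj₁ _) _ (inj₁ _) ()
  edgeCode-injective (inj₁ _) (inj₂ _) (inj₁ _) (inj₁ _) _ (inj₂ _) ()
  edgeCode-injective (inj₂ _) (inj₁ _) (inj₁ _) (inj₁ _) _ (inj₁ _) ()
  edgeCode-injective (inj₂ _) (inj₁ _) (inj₁ _) (inj₁ _) _ (inj₂ _) ()
  edgeCode-injective (inj₁ _) (inj₂ _) (inj₁ _) (inj₂ _) _ _ refl = inj₁ (refl , refl)
  edgeCode-injective (inj₁ _) (inj₂ _) (inj₂ _) (inj₁ _) _ _ refl = inj₂ (refl , refl)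
  edgeCode-injective (inj₂ _) (inj₁ _) (inj₁ _) (inj₂ _) _ _ refl = inj₂ (refl , refl)
  edgeCode-injective (inj₂ _) (inj₁ _) (inj₂ _) (inj₁ _) _ _ refl = inj₁ (refl , refl)

  -- Vertices and edges of the join as codes.

  Code : Set
  Code = (Fin m ⊎ Fin t) ⊎ EdgeCode

  -- A closed form is used because `size G` does not reduce for a variable `m`; `total≡` relates the
  -- two and labels are moved along it by `cast`.
  labels : ℕ
  labels = m + t + (m + m * t)

  code-↔ : Fin labels ↔ Code
  code-↔ = ↔-trans Fin.+↔⊎ (Fin.+↔⊎ ⊎-↔ ↔-trans Fin.+↔⊎ (↔-refl ⊎-↔ Fin.*↔×))

  splitAt-injective : {u v : Fin (m + t)} → splitAt m u ≡ splitAt m v → u ≡ v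
  splitAt-injective {u} {v} eq = trans (sym (Fin.join-splitAt m t u))
    (trans (cong (Fin.join m t) eq) (Fin.join-splitAt m t v))

  toCode : Fin (m + t) ⊎ Edge G → Code
  toCode (inj₁ u)           = inj₁ (splitAt m u)
  toCode (inj₂ (u , v , e)) = inj₂ (edgeCode (splitAt m u) (splitAt m v) e)

  _≈_ : Fin (m + t) ⊎ Edge G → Fin (m + t) ⊎ Edge G → Set
  _≈_ = ⊎.Pointwise _≡_ (SameEdge G)

  toCode-cong : ∀ {a b} → a ≈ b → toCode a ≡ toCode b
  toCode-cong (⊎.inj₁ refl) = refl
  toCode-cong {inj₂ (u , v , e)} {inj₂ (_ , _ , e′)} (⊎.inj₂ (inj₁ (refl , refl))) =
    cong inj₂ (edgeCode-irrelevant (splitAt m u) (splitAt m v) e e′)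
  toCode-cong {inj₂ (u , v , e)} {inj₂ (_ , _ , e′)} (⊎.inj₂ (inj₂ (refl , refl))) =
    cong inj₂ (edgeCode-swap (splitAt m u) (splitAt m v) e e′)

  toCode-injective : ∀ {a b} → toCode a ≡ toCode b → a ≈ b
  toCode-injective {inj₁ u} {inj₁ v} eq = ⊎.inj₁ (splitAt-injective (inj₁-injective eq))
  toCode-injective {inj₂ (u , v , e)} {inj₂ (u′ , v′ , e′)} eq
    with edgeCode-injective (splitAt m u) (splitAt m v) (splitAt m u′) (splitAt m v′) e e′ (inj₂-injective eq)
  ... | inj₁ (p , q) = ⊎.inj₂ (inj₁ (splitAt-injective p , splitAt-injective q))
  ... | inj₂ (p , q) = ⊎.inj₂ (inj₂ (splitAt-injective p , splitAt-injective q))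

  edgeCode-at : ∀ {x y u v} (p : splitAt m u ≡ x) (q : splitAt m v ≡ y) e →
                edgeCode (splitAt m u) (splitAt m v) (Adj⁺ p q e) ≡ edgeCode x y e
  edgeCode-at refl refl e = refl

  toCode-surjective : ∀ c → ∃[ a ] toCode a ≡ c
  toCode-surjective (inj₁ x) = inj₁ (Fin.join m t x) , cong inj₁ (Fin.splitAt-join m t x)
  toCode-surjective (inj₂ (inj₁ i)) = inj₂ (▸ i , ▸ (next i) , cycle-edge (inj₁ (proj₂ (next-exists i)))) ,
    cong inj₂ (edgeCode-at (at-cycle i) (at-cycle (next i)) (inj₁ (proj₂ (next-exists i))))
  toCode-surjective (inj₂ (inj₂ (i , j))) = inj₂ (▸ i , ◂ j , spoke i j) ,
    cong inj₂ (edgeCode-at (at-cycle i) (at-null j) tt)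

  noIsolated : 0 < t → NoIsolated G
  noIsolated 0<t u = neighbour (splitAt m u) refl
    where
    neighbour : ∀ x → splitAt m u ≡ x → ∃[ v ] Adj G u v
    neighbour (inj₁ i) eq = ◂ (fromℕ< 0<t) , Adj⁺ eq (at-null _) tt
    neighbour (inj₂ j) eq = ▸ (fromℕ< (<-≤-trans (s≤s z≤n) 3≤m)) , Adj⁺ eq (at-cycle _) tt

  -- From a labeling of codes to the induced colors.

  module Labeling (L : Code → Fin labels) (L-surjective : ∀ l → ∃[ c ] L c ≡ l) where

    total≡ : labels ≡ m + t + size G
    total≡ = cong (m + t +_) (sym size≡)

    labeling : TotalLabeling G
    labeling = record
      { to        = λ a → cast total≡ (L (toCode a))
      ; cong      = λ eq → cong (cast total≡ ∘ L) (toCode-cong eq)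
      -- By `code-↔` there are as many codes as labels, so the surjection `L` is injective.
      ; bijective = (λ eq → toCode-injective (↔-surjective⇒injective code-↔ L L-surjective (cast-injective eq)))
                  , surjective
      }
      where
      cast-injective : ∀ {i j} → cast total≡ i ≡ cast total≡ j → i ≡ j
      cast-injective eq = Fin.toℕ-injective
        (trans (sym (Fin.toℕ-cast total≡ _)) (trans (cong toℕ eq) (Fin.toℕ-cast total≡ _)))
      surjective : ∀ l → ∃[ a ] (∀ {b} → b ≈ a → cast total≡ (L (toCode b)) ≡ l)
      surjective l with (c , Lc≡l) ← L-surjective (cast (sym total≡) l) with (a , a≡c) ← toCode-surjective c =
        a , λ b≈a → trans (cong (cast total≡) (trans (cong L (trans (toCode-cong b≈a) a≡c)) Lc≡l))
                          (Fin.cast-involutive total≡ (sym total≡) l)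

    ℓ : Code → ℕ
    ℓ c = suc (toℕ (L c))

    vertexLabel-at : ∀ {x u} → splitAt m u ≡ x → vertexLabel G labeling u ≡ ℓ (inj₁ x)
    vertexLabel-at refl = cong suc (Fin.toℕ-cast total≡ _)

    contribution-at : ∀ {x y u v} → splitAt m u ≡ x → splitAt m v ≡ y → (e : JoinAdj (C m 3≤m) (O t) x y) →
      contribution G labeling u v ≡ ℓ (inj₂ (edgeCode x y e)) + ℓ (inj₁ y)
    contribution-at refl refl e = trans (contribution-adjacent G labeling e)
      (cong₂ _+_ (cong suc (Fin.toℕ-cast total≡ _)) (vertexLabel-at refl))

    -- The edge towards `next i` is coded by `i` itself, whereas the edge towards `prev i` is coded
    -- by `prev i`, the same index as the vertex at its far end.
    color-cycle : ∀ i → color G labeling (i ↑ˡ t) ≡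
      (ℓ (inj₂ (inj₁ i)) + ℓ (inj₁ (inj₁ (next i)))) +
      (ℓ (inj₂ (inj₁ (prev i))) + ℓ (inj₁ (inj₁ (prev i)))) +
      sum λ j → ℓ (inj₂ (inj₂ (i , j))) + ℓ (inj₁ (inj₂ j))
    color-cycle i = trans (sum-splitAt m _) (cong₂ _+_
      (trans (sum-pair _ (next≢prev i) λ x x≢next x≢prev → contribution-nonadjacent G labeling λ ix →
                nonadjacent x≢next x≢prev (Adj⁻ (at-cycle i) (at-cycle x) ix))
        (cong₂ _+_
          (contribution-at (at-cycle i) (at-cycle (next i)) (inj₁ (proj₂ (next-exists i))))
          (contribution-at (at-cycle i) (at-cycle (prev i)) (inj₂ (proj₂ (prev-exists i))))))
      (sum-cong-≗ λ j → contribution-at (at-cycle i) (at-null j) tt))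

    color-null : ∀ j → color G labeling (m ↑ʳ j) ≡ sum λ i → ℓ (inj₂ (inj₂ (i , j))) + ℓ (inj₁ (inj₁ i))
    color-null j = trans (sum-splitAt m _) (trans (cong₂ _+_
      (sum-cong-≗ λ i → contribution-at (at-null j) (at-cycle i) tt)
      (sum-zero _ λ j′ → contribution-nonadjacent G labeling λ jj′ → Adj⁻ (at-null j) (at-null j′) jj′))
      (+-identityʳ _))

-- Integer sums and signs.

-- Summands live on all of `ℕ`, so ranges can be split and shifted and periodicity applied without
-- carrying bounds.
∑[<_]_ : ℕ → (ℕ → ℤ) → ℤ
∑[< zero  ] F = 0ℤ
∑[< suc k ] F = F 0 ℤ.+ ∑[< k ] (F ∘ suc)

pos-sum : ∀ {k} (f : Fin k → ℕ) (F : ℕ → ℤ) → (∀ i → pos (f i) ≡ F (toℕ i)) → pos (sum f) ≡ ∑[< k ] F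
pos-sum {zero}  f F eq = refl
pos-sum {suc k} f F eq = trans (ℤ.pos-+ (f Fin.zero) _)
  (cong₂ ℤ._+_ (eq Fin.zero) (pos-sum (f ∘ Fin.suc) (F ∘ suc) (eq ∘ Fin.suc)))

∑-cong : ∀ k {F G : ℕ → ℤ} → (∀ i → F i ≡ G i) → ∑[< k ] F ≡ ∑[< k ] G
∑-cong zero    eq = refl
∑-cong (suc k) eq = cong₂ ℤ._+_ (eq 0) (∑-cong k (eq ∘ suc))

∑-const : ∀ k c → ∑[< k ] (λ _ → c) ≡ pos k ℤ.* c
∑-const zero    c = refl
∑-const (suc k) c = trans (cong (λ z → c ℤ.+ z) (∑-const k c)) (sym (ℤ.suc-* (pos k) c))

∑-* : ∀ k c F → ∑[< k ] (λ i → c ℤ.* F i) ≡ c ℤ.* ∑[< k ] F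
∑-* zero    c F = sym (ℤ.*-zeroʳ c)
∑-* (suc k) c F = trans (cong (λ z → c ℤ.* F 0 ℤ.+ z) (∑-* k c (F ∘ suc))) (sym (ℤ.*-distribˡ-+ c (F 0) _))

∑-+ : ∀ k F G → ∑[< k ] (λ i → F i ℤ.+ G i) ≡ ∑[< k ] F ℤ.+ ∑[< k ] G
∑-+ zero    F G = refl
∑-+ (suc k) F G = trans (cong (λ z → F 0 ℤ.+ G 0 ℤ.+ z) (∑-+ k (F ∘ suc) (G ∘ suc)))
  (interchange (F 0) (G 0) (∑[< k ] (F ∘ suc)) (∑[< k ] (G ∘ suc)))
  where
  interchange : ∀ a b c d → a ℤ.+ b ℤ.+ (c ℤ.+ d) ≡ a ℤ.+ c ℤ.+ (b ℤ.+ d)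
  interchange = ℤ-Solver.solve-∀

∑-split : ∀ k l F → ∑[< k + l ] F ≡ ∑[< k ] F ℤ.+ ∑[< l ] (λ i → F (k + i))
∑-split zero    l F = sym (ℤ.+-identityˡ _)
∑-split (suc k) l F = trans (cong (λ z → F 0 ℤ.+ z) (∑-split k l (F ∘ suc))) (sym (ℤ.+-assoc (F 0) _ _))

-- This is (-1)ⁱ; recursion in steps of two lets a sign survive the removal of an even block by
-- computation alone.
sg : ℕ → ℤ
sg 0             = 1ℤ
sg 1             = -1ℤ
sg (suc (suc i)) = sg i

sg-suc : ∀ i → sg (suc i) ≡ - sg i
sg-suc 0             = refl
sg-suc 1             = refl
sg-suc (suc (suc i)) = sg-suc i

IsSign : ℤ → Set
IsSign δ = δ ≡ 1ℤ ⊎ δ ≡ -1ℤ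

sg-sign : ∀ i → IsSign (sg i)
sg-sign 0             = inj₁ refl
sg-sign 1             = inj₂ refl
sg-sign (suc (suc i)) = sg-sign i

sg-double : ∀ i → sg (i + i) ≡ 1ℤ
sg-double zero    = refl
sg-double (suc i) = trans (cong (sg ∘ suc) (+-suc i i)) (sg-double i)

sg-double+ : ∀ k i → sg (k + k + i) ≡ sg i
sg-double+ zero    i = refl
sg-double+ (suc k) i = trans (cong (λ l → sg (suc (l + i))) (+-suc k k)) (sg-double+ k i)

neg-sign : ∀ {δ} → IsSign δ → IsSign (- δ)
neg-sign (inj₁ refl) = inj₂ refl
neg-sign (inj₂ refl) = inj₁ refl

*-sign : ∀ {δ ε} → IsSign δ → IsSign ε → IsSign (δ ℤ.* ε)
*-sign (inj₁ refl) (inj₁ refl) = inj₁ refl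
*-sign (inj₁ refl) (inj₂ refl) = inj₂ refl
*-sign (inj₂ refl) (inj₁ refl) = inj₂ refl
*-sign (inj₂ refl) (inj₂ refl) = inj₁ refl

sign² : ∀ {δ} → IsSign δ → δ ℤ.* δ ≡ 1ℤ
sign² (inj₁ refl) = refl
sign² (inj₂ refl) = refl

sign-cases : ∀ {δ ε} → IsSign δ → IsSign ε → ε ≡ δ ⊎ ε ≡ - δ
sign-cases (inj₁ refl) (inj₁ refl) = inj₁ refl
sign-cases (inj₁ refl) (inj₂ refl) = inj₂ refl
sign-cases (inj₂ refl) (inj₁ refl) = inj₂ refl
sign-cases (inj₂ refl) (inj₂ refl) = inj₁ refl

∣sign*∣ : ∀ {δ} → IsSign δ → ∀ z → ∣ δ ℤ.* z ∣ ≡ ∣ z ∣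
∣sign*∣ (inj₁ refl) z = cong ∣_∣ (ℤ.*-identityˡ z)
∣sign*∣ (inj₂ refl) z = trans (cong ∣_∣ (ℤ.-1*i≡-i z)) (ℤ.∣-i∣≡∣i∣ z)

-- Arrangements whose signed sums vanish.

-- The indices 2r and 2r + 1 have the same half and opposite signs.
∑-paired : ∀ s (F : ℕ → ℤ) → ∑[< s + s ] (λ j → sg j ℤ.* F ⌊ j /2⌋) ≡ 0ℤ
∑-paired zero    F = refl
∑-paired (suc s) F = begin
  ∑[< suc s + suc s ] f                                     ≡⟨ cong (λ k → ∑[< suc k ] f) (+-suc s s) ⟩
  1ℤ ℤ.* F 0 ℤ.+ (-1ℤ ℤ.* F 0 ℤ.+ ∑[< s + s ] (f ∘ suc ∘ suc))
    ≡⟨ cong (λ z → 1ℤ ℤ.* F 0 ℤ.+ (-1ℤ ℤ.* F 0 ℤ.+ z)) (∑-paired s (F ∘ suc)) ⟩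
  1ℤ ℤ.* F 0 ℤ.+ (-1ℤ ℤ.* F 0 ℤ.+ 0ℤ)                       ≡⟨ cancel (F 0) ⟩
  0ℤ                                                        ∎
  where
  open ≡-Reasoning
  f = λ j → sg j ℤ.* F ⌊ j /2⌋
  cancel : ∀ z → 1ℤ ℤ.* z ℤ.+ (-1ℤ ℤ.* z ℤ.+ 0ℤ) ≡ 0ℤ
  cancel = ℤ-Solver.solve-∀

-- The signs alternate along 0, 1, 3, 2 | 4, 5, 7, 6 | ⋯, so each block of four cancels.
shuffle : ℕ → ℕ
shuffle 0 = 0
shuffle 1 = 1
shuffle 2 = 3
shuffle 3 = 2
shuffle (suc (suc (suc (suc i)))) = 4 + shuffle i

-- The values are the natural numbers other than 3; the signed sum of the first
-- six is 0 − 1 + 4 − 2 + 5 − 6 = 0.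
balanced : ℕ → ℕ
balanced 0 = 0
balanced 1 = 1
balanced 2 = 4
balanced 3 = 2
balanced 4 = 5
balanced 5 = 6
balanced (suc (suc (suc (suc (suc (suc i)))))) = 7 + shuffle i

-- A block contributes c - (c + 1) + (c + 3) - (c + 2) = 0. The offset must be arbitrary because the
-- next block has offset c + 4.
∑-shuffle : ∀ k c → ∑[< k * 4 ] (λ i → sg i ℤ.* (c ℤ.+ pos (shuffle i))) ≡ 0ℤ
∑-shuffle zero    c = refl
∑-shuffle (suc k) c = trans
  (cong (λ z → 1ℤ ℤ.* (c ℤ.+ pos 0) ℤ.+ (-1ℤ ℤ.* (c ℤ.+ pos 1) ℤ.+
                 (1ℤ ℤ.* (c ℤ.+ pos 3) ℤ.+ (-1ℤ ℤ.* (c ℤ.+ pos 2) ℤ.+ z))))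
    (trans (∑-cong (k * 4) λ i → cong (λ z → sg i ℤ.* z) (shift c (pos (shuffle i)))) (∑-shuffle k (c ℤ.+ pos 4))))
  (cancel c)
  where
  shift : ∀ c y → c ℤ.+ (pos 4 ℤ.+ y) ≡ c ℤ.+ pos 4 ℤ.+ y
  shift c y = sym (ℤ.+-assoc c (pos 4) y)
  cancel : ∀ c → 1ℤ ℤ.* (c ℤ.+ pos 0) ℤ.+ (-1ℤ ℤ.* (c ℤ.+ pos 1) ℤ.+
                 (1ℤ ℤ.* (c ℤ.+ pos 3) ℤ.+ (-1ℤ ℤ.* (c ℤ.+ pos 2) ℤ.+ 0ℤ))) ≡ 0ℤ
  cancel = ℤ-Solver.solve-∀

-- The first six terms cancel among themselves. Six is even, so the signs start afresh, and what is
-- left is `∑-shuffle` at offset c + 7.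
∑-balanced : ∀ k c → ∑[< 6 + k * 4 ] (λ i → sg i ℤ.* (c ℤ.+ pos (balanced i))) ≡ 0ℤ
∑-balanced k c = trans
  (cong (λ z → 1ℤ ℤ.* (c ℤ.+ pos 0) ℤ.+ (-1ℤ ℤ.* (c ℤ.+ pos 1) ℤ.+
                 (1ℤ ℤ.* (c ℤ.+ pos 4) ℤ.+ (-1ℤ ℤ.* (c ℤ.+ pos 2) ℤ.+ (1ℤ ℤ.* (c ℤ.+ pos 5) ℤ.+ (-1ℤ ℤ.* (c ℤ.+ pos 6) ℤ.+ z))))))
    (trans (∑-cong (k * 4) λ i → cong (λ z → sg i ℤ.* z) (shift c (pos (shuffle i)))) (∑-shuffle k (c ℤ.+ pos 7))))
  (cancel c)
  where
  shift : ∀ c y → c ℤ.+ (pos 7 ℤ.+ y) ≡ c ℤ.+ pos 7 ℤ.+ y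
  shift c y = sym (ℤ.+-assoc c (pos 7) y)
  cancel : ∀ c → 1ℤ ℤ.* (c ℤ.+ pos 0) ℤ.+ (-1ℤ ℤ.* (c ℤ.+ pos 1) ℤ.+
                 (1ℤ ℤ.* (c ℤ.+ pos 4) ℤ.+ (-1ℤ ℤ.* (c ℤ.+ pos 2) ℤ.+ (1ℤ ℤ.* (c ℤ.+ pos 5) ℤ.+ (-1ℤ ℤ.* (c ℤ.+ pos 6) ℤ.+ 0ℤ))))) ≡ 0ℤ
  cancel = ℤ-Solver.solve-∀

shuffle< : ∀ k {i} → i < k * 4 → shuffle i < k * 4
shuffle< (suc k) {0} _ = s≤s z≤n
shuffle< (suc k) {1} _ = s≤s (s≤s z≤n)
shuffle< (suc k) {2} _ = s≤s (s≤s (s≤s (s≤s z≤n)))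
shuffle< (suc k) {3} _ = s≤s (s≤s (s≤s z≤n))
shuffle< (suc k) {suc (suc (suc (suc i)))} (s≤s (s≤s (s≤s (s≤s i<)))) = +-monoʳ-< 4 (shuffle< k i<)

balanced< : ∀ k {i} → i < 6 + k * 4 → balanced i < 7 + k * 4
balanced< k {0} _ = m≤m+n 1 _
balanced< k {1} _ = m≤m+n 2 _
balanced< k {2} _ = m≤m+n 5 _
balanced< k {3} _ = m≤m+n 3 _
balanced< k {4} _ = m≤m+n 6 _
balanced< k {5} _ = m≤m+n 7 _
balanced< k {suc (suc (suc (suc (suc (suc i)))))} (s≤s (s≤s (s≤s (s≤s (s≤s (s≤s i<)))))) = +-monoʳ-< 7 (shuffle< k i<)

shuffle-onto : ∀ k {c} → c < k * 4 → ∃[ i ] i < k * 4 × shuffle i ≡ c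
shuffle-onto (suc k) {0} _ = 0 , s≤s z≤n , refl
shuffle-onto (suc k) {1} _ = 1 , s≤s (s≤s z≤n) , refl
shuffle-onto (suc k) {2} _ = 3 , s≤s (s≤s (s≤s (s≤s z≤n))) , refl
shuffle-onto (suc k) {3} _ = 2 , s≤s (s≤s (s≤s z≤n)) , refl
shuffle-onto (suc k) {suc (suc (suc (suc c)))} (s≤s (s≤s (s≤s (s≤s c<)))) with (i , i< , eq) ← shuffle-onto k c< =
  4 + i , +-monoʳ-< 4 i< , cong (λ l → 4 + l) eq

balanced-onto : ∀ k {c} → c < 7 + k * 4 → c ≢ 3 → ∃[ i ] i < 6 + k * 4 × balanced i ≡ c
balanced-onto k {0} _ _ = 0 , m≤m+n 1 _ , refl
balanced-onto k {1} _ _ = 1 , m≤m+n 2 _ , refl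
balanced-onto k {2} _ _ = 3 , m≤m+n 4 _ , refl
balanced-onto k {3} _ c≢3 = contradiction refl c≢3
balanced-onto k {4} _ _ = 2 , m≤m+n 3 _ , refl
balanced-onto k {5} _ _ = 4 , m≤m+n 5 _ , refl
balanced-onto k {6} _ _ = 5 , m≤m+n 6 _ , refl
balanced-onto k {suc (suc (suc (suc (suc (suc (suc c))))))} (s≤s (s≤s (s≤s (s≤s (s≤s (s≤s (s≤s c<))))))) _
  with (i , i< , eq) ← shuffle-onto k c< = 6 + i , +-monoʳ-< 6 i< , cong (λ l → 7 + l) eq

-- The index is 2r for a positive sign and 2r + 1 for a negative one.
halves-onto : ∀ {r s δ} → r < s → IsSign δ → ∃[ j ] j < s + s × ⌊ j /2⌋ ≡ r × sg j ≡ δ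
halves-onto {zero}  {suc s} _ (inj₁ refl) = 0 , s≤s z≤n , refl , refl
halves-onto {zero}  {suc s} _ (inj₂ refl) =
  1 , subst (1 <_) (cong suc (sym (+-suc s s))) (s≤s (s≤s z≤n)) , refl , refl
halves-onto {suc r} {suc s} (s≤s r<s) δ± with (j , j< , eq , sg≡) ← halves-onto r<s δ± =
  2 + j , subst (2 + j <_) (cong suc (sym (+-suc s s))) (s≤s (s≤s j<)) , cong suc eq , sg≡

even-or-odd : ∀ r → ∃[ j ] (r ≡ j + j ⊎ r ≡ suc (j + j))
even-or-odd zero = 0 , inj₁ refl
even-or-odd (suc r) with even-or-odd r
... | j , inj₁ refl = j , inj₂ refl
... | j , inj₂ refl = suc j , inj₁ (cong suc (sym (+-suc j j)))

-- Halving modulo an odd number.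

module OddPeriod (n : ℕ) where

  h : ℕ
  h = suc (n + n)

  -- n + 1 is the inverse of 2 modulo h.
  half : ℕ → ℕ
  half i = (i * suc n) % h

  periodic-% : ∀ {A : Set} {F : ℕ → A} → (∀ i → F (h + i) ≡ F i) → ∀ i → F (i % h) ≡ F i
  periodic-% {F = F} period i = trans (sym (multiple (i / h)))
    (cong F (trans (+-comm (i / h * h) _) (sym (m≡m%n+[m/n]*n i h))))
    where
    multiple : ∀ q → F (q * h + i % h) ≡ F (i % h)
    multiple zero    = refl
    multiple (suc q) = trans (cong F (+-assoc h (q * h) (i % h))) (trans (period _) (multiple q))

  suc-%-periodic : ∀ i → suc (h + i) % h ≡ suc i % h
  suc-%-periodic i = trans (cong (λ l → suc l % h) (+-comm h i)) ([m+n]%n≡m%n (suc i) h)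

  half-periodic : ∀ i → half (h + i) ≡ half i
  half-periodic i = trans (cong (_% h) (lemma i n)) ([m+kn]%n≡m%n (i * suc n) (suc n) h)
    where
    lemma : ∀ i n → (suc (n + n) + i) * suc n ≡ i * suc n + suc n * suc (n + n)
    lemma = ℕ-Solver.solve-∀

  half-even : ∀ {j} → j < h → half (j + j) ≡ j
  half-even {j} j<h = trans (cong (_% h) (lemma j n)) (trans ([m+kn]%n≡m%n j j h) (m<n⇒m%n≡m j<h))
    where
    lemma : ∀ j n → (j + j) * suc n ≡ j + j * suc (n + n)
    lemma = ℕ-Solver.solve-∀

  half-odd : ∀ j → half (suc (j + j)) ≡ (j + suc n) % h
  half-odd j = trans (cong (_% h) (lemma j n)) ([m+kn]%n≡m%n (j + suc n) j h)
    where
    lemma : ∀ j n → suc (j + j) * suc n ≡ j + suc n + j * suc (n + n)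
    lemma = ℕ-Solver.solve-∀

  private
    halve-≤ : ∀ {j} → j + j ≤ n + n → j ≤ n
    halve-≤ {j} 2j≤2n with j ≤? n
    ... | yes j≤n = j≤n
    ... | no j≰n  = contradiction 2j≤2n (<⇒≱ (+-mono-< (≰⇒> j≰n) (≰⇒> j≰n)))

    odd-value : ∀ {j} → j < n → half (suc (j + j)) ≡ j + suc n
    odd-value {j} j<n = trans (half-odd j)
      (m<n⇒m%n≡m (subst (_< h) (sym (+-suc j n)) (s≤s (+-monoˡ-< n j<n))))

    n<h : n < h
    n<h = s≤s (m≤m+n n n)

  -- Modulo `h` both sides are i + 1/2 + i/2 - i/2, that is i + n + 1. For equality of naturals,
  -- reduce to a residue r: if r = 2j with j < n, the halves are j and j + n + 1; if r = 2j + 1,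
  -- they are j + n + 1 and j + 1.
  half-consecutive : ∀ i → half i + half (suc i) ≡ n + suc i % h
  half-consecutive i = begin
    half i + half (suc i)              ≡⟨ cong₂ _+_ (periodic-% half-periodic i) (periodic-% suc-periodic i) ⟨
    half (i % h) + half (suc (i % h))  ≡⟨ below (i % h) (m%n<n i h) ⟩
    n + suc (i % h) % h                ≡⟨ cong (n +_) (periodic-% suc-%-periodic i) ⟩
    n + suc i % h                      ∎
    where
    open ≡-Reasoning
    suc-periodic : ∀ i → half (suc (h + i)) ≡ half (suc i)
    suc-periodic i = trans (cong half (sym (+-suc h i))) (half-periodic (suc i))

    below : ∀ r → r < h → half r + half (suc r) ≡ n + suc r % h
    below r r<h with even-or-odd r
    ... | j , inj₁ refl with m≤n⇒m<n∨m≡n {j} {n} (halve-≤ (≤-pred r<h))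
    ...   | inj₁ j<n = begin
      half (j + j) + half (suc (j + j))  ≡⟨ cong₂ _+_ (half-even (<-trans j<n n<h)) (odd-value j<n) ⟩
      j + (j + suc n)                    ≡⟨ lemma j n ⟩
      n + suc (j + j)                    ≡⟨ cong (n +_) (m<n⇒m%n≡m (s≤s (+-mono-< j<n j<n))) ⟨
      n + suc (j + j) % h                ∎
      where
      lemma : ∀ j n → j + (j + suc n) ≡ n + suc (j + j)
      lemma = ℕ-Solver.solve-∀
    -- Here r = 2n is the last residue: its half is n, and its successor wraps to 0 on both sides.
    ...   | inj₂ refl = cong₂ _+_ (half-even n<h)
      (trans (half-odd n) (cong (_% h) (+-suc n n)))
    below r r<h | j , inj₂ refl = begin
      half (suc (j + j)) + half (suc (suc (j + j)))
        ≡⟨ cong₂ _+_ (odd-value j<n)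
             (trans (cong (half ∘ suc) (sym (+-suc j j))) (half-even (<-≤-trans (s≤s j<n) n<h))) ⟩
      j + suc n + suc j
        ≡⟨ lemma j n ⟩
      n + suc (suc (j + j))
        ≡⟨ cong (n +_) (m<n⇒m%n≡m (s≤s (≤-trans (≤-reflexive (cong suc (sym (+-suc j j)))) (+-mono-≤ j<n j<n)))) ⟨
      n + suc (suc (j + j)) % h ∎
      where
      j<n : j < n
      j<n = ≰⇒> λ n≤j → <⇒≱ (≤-pred r<h) (+-mono-≤ n≤j n≤j)
      lemma : ∀ j n → j + suc n + suc j ≡ n + suc (suc (j + j))
      lemma = ℕ-Solver.solve-∀

  sg-antiperiodic : ∀ i → sg (h + i) ≡ - sg i
  sg-antiperiodic i = trans (sg-suc (n + n + i)) (cong -_ (sg-double+ n i))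

  -- As h is odd, the two lifts of a residue mod h to {0, …, 2h − 1} have opposite signs.
  lift-with-sign : ∀ {F : ℕ → ℕ} → (∀ i → F (h + i) ≡ F i) → ∀ i {δ} → IsSign δ →
                   ∃[ i′ ] i′ < h + h × F i′ ≡ F i × sg i′ ≡ δ
  lift-with-sign {F} period i δ± with sign-cases δ± (sg-sign (i % h))
  ... | inj₁ same     = i % h , <-≤-trans (m%n<n i h) (m≤m+n h h) , periodic-% period i , same
  ... | inj₂ opposite = h + i % h , +-monoʳ-< h (m%n<n i h) , trans (period _) (periodic-% period i) ,
                        trans (sg-antiperiodic (i % h)) (trans (cong -_ opposite) (ℤ.neg-involutive _))

  half-onto : ∀ {c δ} → c < h → IsSign δ → ∃[ i ] i < h + h × half i ≡ c × sg i ≡ δ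
  half-onto {c} c<h δ± with (i , i< , eq , sg≡) ← lift-with-sign half-periodic (c + c) δ± =
    i , i< , trans eq (half-even c<h) , sg≡

  suc-%-onto : ∀ {c δ} → c < h → IsSign δ → ∃[ i ] i < h + h × suc i % h ≡ c × sg i ≡ δ
  -- `n + n` is -1 modulo `h`, so the successor of the witness is `h + c`.
  suc-%-onto {c} c<h δ± with (i , i< , eq , sg≡) ← lift-with-sign suc-%-periodic (n + n + c) δ± =
    i , i< , trans eq (trans (cong (_% h) (+-comm h c)) (trans ([m+n]%n≡m%n c h) (m<n⇒m%n≡m c<h))) , sg≡

  -- The terms at i and h + i cancel, since shifting by the odd `h` flips the sign and keeps `F`.
  ∑-antiperiodic : ∀ {F : ℕ → ℕ} → (∀ i → F (h + i) ≡ F i) → ∑[< h + h ] (λ i → sg i ℤ.* pos (F i)) ≡ 0ℤ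
  ∑-antiperiodic {F} period = begin
    ∑[< h + h ] f                          ≡⟨ ∑-split h h f ⟩
    ∑[< h ] f ℤ.+ ∑[< h ] (λ i → f (h + i))  ≡⟨ ∑-+ h f (λ i → f (h + i)) ⟨
    ∑[< h ] (λ i → f i ℤ.+ f (h + i))      ≡⟨ ∑-cong h cancel ⟩
    ∑[< h ] (λ _ → 0ℤ)                     ≡⟨ ∑-const h 0ℤ ⟩
    pos h ℤ.* 0ℤ                             ≡⟨ ℤ.*-zeroʳ (pos h) ⟩
    0ℤ                                     ∎
    where
    open ≡-Reasoning
    f = λ i → sg i ℤ.* pos (F i)
    lemma : ∀ x y → x ℤ.* y ℤ.+ - x ℤ.* y ≡ 0ℤ
    lemma = ℤ-Solver.solve-∀
    cancel : ∀ i → f i ℤ.+ f (h + i) ≡ 0ℤ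
    cancel i = trans
      (cong (λ z → f i ℤ.+ z) (cong₂ (λ x y → x ℤ.* pos y) (sg-antiperiodic i) (period i)))
      (lemma (sg i) (pos (F i)))

-- Centred values as labels.

-- Here `l` counts from 0, so the label it stands for is `suc K + z`, with the value 0 at the middle
-- label.
recenter : ∀ K {z} → ∣ z ∣ ≤ K → ∃[ l ] l < suc (K + K) × pos l ≡ pos K ℤ.+ z
recenter K {pos y}     y≤K = K + y , s≤s (+-monoʳ-≤ K y≤K) , refl
recenter K { -[1+ y ]} y<K = K ∸ suc y , s≤s (≤-trans (m∸n≤m K (suc y)) (m≤m+n K K)) , sym (ℤ.⊖-≥ y<K)

center : ∀ K {l} → l < suc (K + K) → ∃[ z ] ∣ z ∣ ≤ K × pos K ℤ.+ z ≡ pos l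
center K {l} (s≤s l≤2K) with l ≤? K
... | yes l≤K = - pos (K ∸ l) , subst (_≤ K) (sym (ℤ.∣-i∣≡∣i∣ (pos (K ∸ l)))) (m∸n≤m K l) ,
  trans (ℤ.m-n≡m⊖n K (K ∸ l)) (trans (ℤ.⊖-≥ (m∸n≤m K l)) (cong pos (m∸[m∸n]≡n l≤K)))
... | no l≰K  = pos (l ∸ K) , m≤n+o⇒m∸n≤o l K l≤2K , cong pos (m+[n∸m]≡n (<⇒≤ (≰⇒> l≰K)))

⌊/2⌋< : ∀ {s j} → j < s + s → ⌊ j /2⌋ < s
⌊/2⌋< {suc s} {0}           _        = s≤s z≤n
⌊/2⌋< {suc s} {1}           _        = s≤s z≤n
⌊/2⌋< {suc s} {suc (suc j)} (s≤s j<) = s≤s (⌊/2⌋< (≤-pred (subst (suc j <_) (+-suc s s) j<)))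

split-< : ∀ h {y z} → y < h + z → y < h ⊎ ∃[ y′ ] y′ < z × y ≡ h + y′
split-< h {y} y<h+z with y <? h
... | yes y<h = inj₁ y<h
... | no y≮h  = inj₂ (y ∸ h , +-cancelˡ-< h _ _ (subst (_< h + _) (sym y≡) y<h+z) , sym y≡)
  where y≡ = m+[n∸m]≡n (≮⇒≥ y≮h)

-- The labeling and its surjectivity.

module Construction (n k s m t : ℕ) (0<n : 0 < n) (3≤m : 3 ≤ m)
  -- The cycle length is used in two forms: twice an odd number for the antiperiodic sums, and six
  -- plus blocks of four for `balanced`. Together they make `k` equal to n - 1.
  (m≡h+h : m ≡ suc (n + n) + suc (n + n)) (m≡6+4k : m ≡ 6 + k * 4) (t≡1+2s : t ≡ suc (s + s)) where

  open OddPeriod n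
  open CycleJoin m t 3≤m

  K μ : ℕ
  K = h + (h + (h + s * suc m))
  μ = suc K

  -- Entry `c` of the block `r` of moduli beyond 3h. A block has `suc m` moduli: `balanced` spreads
  -- all but entry 3 over the spokes, and entry 3 goes to the null vertices.
  level : ℕ → ℕ → ℕ
  level r c = suc (h + (h + (h + (r * suc m + c))))

  cycleValue rimValue nullValue : ℕ → ℤ
  cycleValue i = sg i ℤ.* pos (suc (half i))
  rimValue i = sg (suc i) ℤ.* pos (suc (h + (h + half i)))
  nullValue zero    = 0ℤ
  nullValue (suc j) = sg j ℤ.* pos (level ⌊ j /2⌋ 3)

  spokeValue : ℕ → ℕ → ℤ
  spokeValue i zero    = sg i ℤ.* pos (suc (h + suc i % h))
  spokeValue i (suc j) = sg j ℤ.* (sg i ℤ.* pos (level ⌊ j /2⌋ (balanced i)))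

  value : Code → ℤ
  value (inj₁ (inj₁ i))       = cycleValue (toℕ i)
  value (inj₁ (inj₂ j))       = nullValue (toℕ j)
  value (inj₂ (inj₁ i))       = rimValue (toℕ i)
  value (inj₂ (inj₂ (i , j))) = spokeValue (toℕ i) (toℕ j)

  private
    signed-bound : ∀ i {y} → y < K → ∣ sg i ℤ.* pos (suc y) ∣ ≤ K
    signed-bound i {y} = subst (_≤ K) (sym (∣sign*∣ (sg-sign i) (pos (suc y))))

    half< : ∀ i → half i < h
    half< i = m%n<n (i * suc n) h

    level-bound : ∀ {r c} → r < s → c < suc m → level r c ≤ K
    level-bound {r} {c} r<s c<1+m = +-monoʳ-< h (+-monoʳ-< h (+-monoʳ-< h (begin-strict
      r * suc m + c      <⟨ +-monoʳ-< (r * suc m) c<1+m ⟩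
      r * suc m + suc m  ≡⟨ +-comm (r * suc m) (suc m) ⟩
      suc r * suc m      ≤⟨ *-monoˡ-≤ (suc m) r<s ⟩
      s * suc m          ∎)))
      where open ≤-Reasoning

    half-index : ∀ (j : Fin t) {j′} → toℕ j ≡ suc j′ → ⌊ j′ /2⌋ < s
    half-index j eq = ⌊/2⌋< (≤-pred (subst₂ _<_ eq t≡1+2s (Fin.toℕ<n j)))

    balanced<1+m : ∀ (i : Fin m) → balanced (toℕ i) < suc m
    balanced<1+m i = subst (balanced (toℕ i) <_) (cong suc (sym m≡6+4k))
      (balanced< k (subst (toℕ i <_) m≡6+4k (Fin.toℕ<n i)))

  value-bound : ∀ c → ∣ value c ∣ ≤ K
  value-bound (inj₁ (inj₁ i)) = signed-bound (toℕ i) (<-≤-trans (half< (toℕ i)) (m≤m+n h _))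
  value-bound (inj₁ (inj₂ j)) with toℕ j in eq
  ... | zero   = z≤n
  ... | suc j′ = signed-bound j′ (level-bound (half-index j eq) (s≤s 3≤m))
  value-bound (inj₂ (inj₁ i)) = signed-bound (suc (toℕ i))
    (+-monoʳ-< h (+-monoʳ-< h (<-≤-trans (half< (toℕ i)) (m≤m+n h _))))
  value-bound (inj₂ (inj₂ (i , j))) with toℕ j in eq
  ... | zero   = signed-bound (toℕ i) (+-monoʳ-< h (<-≤-trans (m%n<n (suc (toℕ i)) h) (m≤m+n h _)))
  ... | suc j′ = subst (_≤ K) (sym (∣sign*∣ (sg-sign j′) _))
    (signed-bound (toℕ i) (level-bound (half-index j eq) (balanced<1+m i)))

  private
    cycleIndex : ∀ {i} → i < h + h → Fin m
    cycleIndex {i} i< = fromℕ< (subst (i <_) (sym m≡h+h) i<)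

    nullIndex : ∀ {j} → j < suc (s + s) → Fin t
    nullIndex {j} j< = fromℕ< (subst (j <_) (sym t≡1+2s) j<)

    toℕ-cycleIndex : ∀ {i} (i< : i < h + h) → toℕ (cycleIndex i<) ≡ i
    toℕ-cycleIndex i< = Fin.toℕ-fromℕ< _

    toℕ-nullIndex : ∀ {j} (j< : j < suc (s + s)) → toℕ (nullIndex j<) ≡ j
    toℕ-nullIndex j< = Fin.toℕ-fromℕ< _

  -- The moduli are peeled off in intervals of length `h`, held in turn by cycle vertices, spokes to
  -- the first null vertex and cycle edges. Division by `suc m` then locates the block and the entry
  -- of whatever is left.
  signed-onto : ∀ {δ y} → IsSign δ → y < K → ∃[ c ] value c ≡ δ ℤ.* pos (suc y)
  signed-onto {δ} {y} δ± y<K with split-< h y<K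
  ... | inj₁ y<h with (i , i< , eq , sg≡) ← half-onto y<h δ± =
    inj₁ (inj₁ (cycleIndex i<)) ,
    trans (cong cycleValue (toℕ-cycleIndex i<)) (cong₂ (λ σ l → σ ℤ.* pos (suc l)) sg≡ eq)
  ... | inj₂ (y₁ , y₁< , refl) with split-< h y₁<
  ... | inj₁ y₁<h with (i , i< , eq , sg≡) ← suc-%-onto y₁<h δ± =
    inj₂ (inj₂ (cycleIndex i< , nullIndex (s≤s z≤n))) ,
    trans (cong₂ spokeValue (toℕ-cycleIndex i<) (toℕ-nullIndex (s≤s z≤n)))
          (cong₂ (λ σ l → σ ℤ.* pos (suc (h + l))) sg≡ eq)
  ... | inj₂ (y₂ , y₂< , refl) with split-< h y₂<
  -- `rimValue i` carries the sign of `suc i`, so an index of sign -δ is needed.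
  ... | inj₁ y₂<h with (i , i< , eq , sg≡) ← half-onto y₂<h (neg-sign δ±) =
    inj₂ (inj₁ (cycleIndex i<)) ,
    trans (cong rimValue (toℕ-cycleIndex i<))
      (cong₂ (λ σ l → σ ℤ.* pos (suc (h + (h + l))))
        (trans (sg-suc i) (trans (cong -_ sg≡) (ℤ.neg-involutive δ))) eq)
  ... | inj₂ (y₃ , y₃< , refl) = outer (y₃ % suc m ≟ 3)
    where
    r c : ℕ
    r = y₃ / suc m
    c = y₃ % suc m

    level-rc : level r c ≡ suc (h + (h + (h + y₃)))
    level-rc = cong (λ l → suc (h + (h + (h + l))))
      (trans (+-comm (r * suc m) c) (sym (m≡m%n+[m/n]*n y₃ (suc m))))

    r<s : r < s
    r<s = m<n*o⇒m/o<n y₃<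

    outer : Dec (c ≡ 3) → ∃[ d ] value d ≡ δ ℤ.* pos (suc (h + (h + (h + y₃))))
    outer (yes c≡3) with (j , j< , eq , sg≡) ← halves-onto r<s δ± =
      inj₁ (inj₂ (nullIndex (s≤s j<))) ,
      trans (cong nullValue (toℕ-nullIndex (s≤s j<)))
        (cong₂ (λ σ l → σ ℤ.* pos l) sg≡ (trans (cong₂ level eq (sym c≡3)) level-rc))
    outer (no c≢3)
      with (i , i< , eq) ← balanced-onto k (subst (c <_) (cong suc m≡6+4k) (m%n<n y₃ (suc m))) c≢3
      -- The entry `c` fixes `i`, and with it the factor `sg i`; choosing `j` of sign δ times `sg i`
      -- corrects the product to δ.
      with (j , j< , eq′ , sg≡) ← halves-onto r<s (*-sign δ± (sg-sign i)) =
      inj₂ (inj₂ (fromℕ< i<m , nullIndex (s≤s j<))) ,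
      (begin
        spokeValue (toℕ (fromℕ< i<m)) (toℕ (nullIndex (s≤s j<)))
          ≡⟨ cong₂ spokeValue (Fin.toℕ-fromℕ< i<m) (toℕ-nullIndex (s≤s j<)) ⟩
        sg j ℤ.* (sg i ℤ.* pos (level ⌊ j /2⌋ (balanced i)))
          ≡⟨ cong₂ (λ σ l → σ ℤ.* (sg i ℤ.* pos l)) sg≡ (trans (cong₂ level eq′ eq) level-rc) ⟩
        δ ℤ.* sg i ℤ.* (sg i ℤ.* Y)
          ≡⟨ regroup δ (sg i) Y ⟩
        sg i ℤ.* sg i ℤ.* (δ ℤ.* Y)
          ≡⟨ cong (λ σ → σ ℤ.* (δ ℤ.* Y)) (sign² (sg-sign i)) ⟩
        1ℤ ℤ.* (δ ℤ.* Y)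
          ≡⟨ ℤ.*-identityˡ (δ ℤ.* Y) ⟩
        δ ℤ.* Y ∎)
      where
      open ≡-Reasoning
      i<m : i < m
      i<m = subst (i <_) (sym m≡6+4k) i<
      Y : ℤ
      Y = pos (suc (h + (h + (h + y₃))))
      regroup : ∀ δ σ y → δ ℤ.* σ ℤ.* (σ ℤ.* y) ≡ σ ℤ.* σ ℤ.* (δ ℤ.* y)
      regroup = ℤ-Solver.solve-∀

  value-onto : ∀ z → ∣ z ∣ ≤ K → ∃[ c ] value c ≡ z
  value-onto (pos zero)    _   = inj₁ (inj₂ (nullIndex (s≤s z≤n))) , cong nullValue (toℕ-nullIndex (s≤s z≤n))
  value-onto (pos (suc y)) y<K with (c , eq) ← signed-onto (inj₁ refl) y<K = c , trans eq (ℤ.*-identityˡ _)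
  value-onto (-[1+ y ])    y<K with (c , eq) ← signed-onto (inj₂ refl) y<K = c , trans eq (ℤ.-1*i≡-i _)

  labels≡ : labels ≡ suc (K + K)
  labels≡ = trans (cong₂ (λ m t → m + t + (m + m * t)) m≡h+h t≡1+2s)
    -- The polynomial identity is in `h` and `s` alone; `K′` then restores `m` in the block length
    -- inside `K`.
    (trans (lemma h s) (cong (λ m → suc (K′ m + K′ m)) (sym m≡h+h)))
    where
    K′ : ℕ → ℕ
    K′ m = h + (h + (h + s * suc m))
    lemma : ∀ h s → h + h + suc (s + s) + (h + h + (h + h) * suc (s + s)) ≡
            suc (h + (h + (h + s * suc (h + h))) + (h + (h + (h + s * suc (h + h)))))
    lemma = ℕ-Solver.solve-∀

  label : Code → Fin labels
  label c = fromℕ< (subst (proj₁ (recenter K {value c} (value-bound c)) <_) (sym labels≡)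
    (proj₁ (proj₂ (recenter K {value c} (value-bound c)))))

  label-value : ∀ c → pos (toℕ (label c)) ≡ pos K ℤ.+ value c
  label-value c = trans (cong pos (Fin.toℕ-fromℕ< _)) (proj₂ (proj₂ (recenter K {value c} (value-bound c))))

  label-surjective : ∀ l → ∃[ c ] label c ≡ l
  label-surjective l with (z , z≤K , eq) ← center K (subst (toℕ l <_) labels≡ (Fin.toℕ<n l))
                     with (c , value≡z) ← value-onto z z≤K =
    c , Fin.toℕ-injective (ℤ.+-injective (trans (label-value c) (trans (cong (λ w → pos K ℤ.+ w) value≡z) eq)))

  -- The induced colors.

  open Labeling label label-surjective

  ℓ-value : ∀ c → pos (ℓ c) ≡ pos μ ℤ.+ value c
  ℓ-value c = trans (cong (λ w → 1ℤ ℤ.+ w) (label-value c)) (sym (ℤ.+-assoc 1ℤ (pos K) (value c)))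

  M Λ : ℤ
  M = pos μ
  Λ = (M ℤ.+ M) ℤ.+ (M ℤ.+ M) ℤ.+ pos t ℤ.* (M ℤ.+ M)

  -- After the first null vertex, whose own value is 0, the null vertices come in pairs with a
  -- common block and opposite signs. Factoring out `sg j` from spoke and vertex alike leaves a sum
  -- that `∑-paired` cancels.
  ∑-spokes : ∀ (i : Fin m) → pos (sum λ j → ℓ (inj₂ (inj₂ (i , j))) + ℓ (inj₁ (inj₂ j))) ≡
             pos t ℤ.* (M ℤ.+ M) ℤ.+ spokeValue (toℕ i) 0
  ∑-spokes i = begin
    pos (sum λ j → ℓ (inj₂ (inj₂ (i , j))) + ℓ (inj₁ (inj₂ j)))
      ≡⟨ pos-sum _ F (λ j → cong₂ ℤ._+_ (ℓ-value (inj₂ (inj₂ (i , j)))) (ℓ-value (inj₁ (inj₂ j)))) ⟩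
    ∑[< t ] F
      ≡⟨ cong (λ l → ∑[< l ] F) t≡1+2s ⟩
    F 0 ℤ.+ ∑[< s + s ] (F ∘ suc)
      ≡⟨ cong (λ z → F 0 ℤ.+ z) (∑-cong (s + s) λ j → factor M (sg j) (sg (toℕ i)) (lev₁ ⌊ j /2⌋) (lev₂ ⌊ j /2⌋)) ⟩
    F 0 ℤ.+ ∑[< s + s ] (λ j → (M ℤ.+ M) ℤ.+ sg j ℤ.* pair ⌊ j /2⌋)
      ≡⟨ cong (λ z → F 0 ℤ.+ z) (∑-+ (s + s) (λ _ → M ℤ.+ M) (λ j → sg j ℤ.* pair ⌊ j /2⌋)) ⟩
    F 0 ℤ.+ (∑[< s + s ] (λ _ → M ℤ.+ M) ℤ.+ ∑[< s + s ] (λ j → sg j ℤ.* pair ⌊ j /2⌋))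
      ≡⟨ cong₂ (λ x y → F 0 ℤ.+ (x ℤ.+ y)) (∑-const (s + s) (M ℤ.+ M)) (∑-paired s pair) ⟩
    F 0 ℤ.+ (pos (s + s) ℤ.* (M ℤ.+ M) ℤ.+ 0ℤ)
      ≡⟨ collect M (spokeValue (toℕ i) 0) (pos (s + s)) ⟩
    pos (suc (s + s)) ℤ.* (M ℤ.+ M) ℤ.+ spokeValue (toℕ i) 0
      ≡⟨ cong (λ l → pos l ℤ.* (M ℤ.+ M) ℤ.+ spokeValue (toℕ i) 0) t≡1+2s ⟨
    pos t ℤ.* (M ℤ.+ M) ℤ.+ spokeValue (toℕ i) 0 ∎
    where
    open ≡-Reasoning
    F lev₁ lev₂ pair : ℕ → ℤ
    F j = M ℤ.+ spokeValue (toℕ i) j ℤ.+ (M ℤ.+ nullValue j)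
    lev₁ r = pos (level r (balanced (toℕ i)))
    lev₂ r = pos (level r 3)
    pair r = sg (toℕ i) ℤ.* lev₁ r ℤ.+ lev₂ r
    factor : ∀ M σ τ x y → M ℤ.+ σ ℤ.* (τ ℤ.* x) ℤ.+ (M ℤ.+ σ ℤ.* y) ≡ (M ℤ.+ M) ℤ.+ σ ℤ.* (τ ℤ.* x ℤ.+ y)
    factor = ℤ-Solver.solve-∀
    collect : ∀ M b S → M ℤ.+ b ℤ.+ (M ℤ.+ 0ℤ) ℤ.+ (S ℤ.* (M ℤ.+ M) ℤ.+ 0ℤ) ≡ (1ℤ ℤ.+ S) ℤ.* (M ℤ.+ M) ℤ.+ b
    collect = ℤ-Solver.solve-∀

  -- If `F` closes up after one turn of the cycle, the wrap-around step can be treated like any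
  -- other successor.
  along-Next : ∀ {A : Set} (F : ℕ → A) → F (h + h) ≡ F 0 → {i i′ : Fin m} → Next i i′ → F (toℕ i′) ≡ F (suc (toℕ i))
  along-Next F _      (inj₁ e)       = cong F e
  along-Next F wrapped (inj₂ (e , z)) = trans (cong F z) (trans (sym wrapped) (cong F (trans (sym m≡h+h) (sym e))))

  sg-Next : {i i′ : Fin m} → Next i i′ → sg (toℕ i′) ≡ - sg (toℕ i)
  sg-Next {i} ii′ = trans (along-Next sg (sg-double h) ii′) (sg-suc (toℕ i))

  half-Next : {i i′ : Fin m} → Next i i′ → half (toℕ i′) ≡ half (suc (toℕ i))
  half-Next = along-Next half (trans (half-periodic h) (trans (cong half (sym (+-identityʳ h))) (half-periodic 0)))

  -- The half of the previous index cancels between that edge and that vertex. Up to the sign σ,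
  -- what remains is h - 1 + (i + 1 mod h) minus two consecutive halves; by `half-consecutive` this
  -- is 2n - n.
  values-around : ∀ i → (rimValue (toℕ i) ℤ.+ cycleValue (toℕ (next i))) ℤ.+
                        (rimValue (toℕ (prev i)) ℤ.+ cycleValue (toℕ (prev i))) ℤ.+
                        spokeValue (toℕ i) 0 ≡ sg (toℕ i) ℤ.* pos n
  values-around i = begin
    (rimValue u ℤ.+ cycleValue v) ℤ.+ (rimValue w ℤ.+ cycleValue w) ℤ.+ spokeValue u 0
      ≡⟨ cong₂ (λ x y → x ℤ.+ y ℤ.+ spokeValue u 0)
           (cong₂ ℤ._+_ (cong (λ τ → τ ℤ.* pos (suc (h + (h + half u)))) (sg-suc u))
                        (cong₂ (λ τ l → τ ℤ.* pos (suc l)) (sg-Next i→v) (half-Next i→v)))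
           (cong₂ (λ τ τ′ → τ ℤ.* pos (suc (h + (h + half w))) ℤ.+ τ′ ℤ.* pos (suc (half w)))
                  sg-w (trans (sym (ℤ.neg-involutive _)) (cong -_ (sym (sg-Next w→i))))) ⟩
    (- σ ℤ.* pos (suc (h + (h + half u))) ℤ.+ - σ ℤ.* pos (suc (half (suc u)))) ℤ.+
    (σ ℤ.* pos (suc (h + (h + half w))) ℤ.+ - σ ℤ.* pos (suc (half w))) ℤ.+
    σ ℤ.* pos (suc (h + suc u % h))
      ≡⟨ around σ (pos n) (pos (half u)) (pos (half (suc u))) (pos (half w)) (pos (suc u % h)) ⟩
    σ ℤ.* pos n ℤ.+ σ ℤ.* (pos (n + suc u % h) ℤ.+ - pos (half u + half (suc u)))
      ≡⟨ cong (λ l → σ ℤ.* pos n ℤ.+ σ ℤ.* (pos (n + suc u % h) ℤ.+ - pos l)) (half-consecutive u) ⟩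
    σ ℤ.* pos n ℤ.+ σ ℤ.* (pos (n + suc u % h) ℤ.+ - pos (n + suc u % h))
      ≡⟨ cancel σ (pos n) (pos (n + suc u % h)) ⟩
    σ ℤ.* pos n ∎
    where
    open ≡-Reasoning
    u v w : ℕ
    u = toℕ i
    v = toℕ (next i)
    w = toℕ (prev i)
    σ : ℤ
    σ = sg u
    i→v : Next i (next i)
    i→v = proj₂ (next-exists i)
    w→i : Next (prev i) i
    w→i = proj₂ (prev-exists i)
    sg-w : sg (suc w) ≡ σ
    sg-w = sym (along-Next sg (sg-double h) w→i)
    -- `h` is spelled out as 1 + (N + N), so that the solver can compare it with N.
    around : ∀ σ N A D B E →
      (- σ ℤ.* (1ℤ ℤ.+ (1ℤ ℤ.+ (N ℤ.+ N) ℤ.+ (1ℤ ℤ.+ (N ℤ.+ N) ℤ.+ A))) ℤ.+ - σ ℤ.* (1ℤ ℤ.+ D)) ℤ.+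
      (σ ℤ.* (1ℤ ℤ.+ (1ℤ ℤ.+ (N ℤ.+ N) ℤ.+ (1ℤ ℤ.+ (N ℤ.+ N) ℤ.+ B))) ℤ.+ - σ ℤ.* (1ℤ ℤ.+ B)) ℤ.+
      σ ℤ.* (1ℤ ℤ.+ (1ℤ ℤ.+ (N ℤ.+ N) ℤ.+ E)) ≡
      σ ℤ.* N ℤ.+ σ ℤ.* (N ℤ.+ E ℤ.+ - (A ℤ.+ D))
    around = ℤ-Solver.solve-∀
    cancel : ∀ σ N x → σ ℤ.* N ℤ.+ σ ℤ.* (x ℤ.+ - x) ≡ σ ℤ.* N
    cancel = ℤ-Solver.solve-∀

  color-cycle-value : ∀ i → pos (color G labeling (i ↑ˡ t)) ≡ Λ ℤ.+ sg (toℕ i) ℤ.* pos n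
  color-cycle-value i = begin
    pos (color G labeling (i ↑ˡ t))
      ≡⟨ cong pos (color-cycle i) ⟩
    pos (ℓ rimᵢ) ℤ.+ pos (ℓ cycₙ) ℤ.+ (pos (ℓ rimₚ) ℤ.+ pos (ℓ cycₚ)) ℤ.+ pos spokes
      ≡⟨ cong₂ ℤ._+_ (cong₂ ℤ._+_ (cong₂ ℤ._+_ (ℓ-value rimᵢ) (ℓ-value cycₙ))
                                  (cong₂ ℤ._+_ (ℓ-value rimₚ) (ℓ-value cycₚ))) (∑-spokes i) ⟩
    (M ℤ.+ value rimᵢ ℤ.+ (M ℤ.+ value cycₙ)) ℤ.+ (M ℤ.+ value rimₚ ℤ.+ (M ℤ.+ value cycₚ)) ℤ.+
    (pos t ℤ.* (M ℤ.+ M) ℤ.+ spokeValue (toℕ i) 0)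
      ≡⟨ collect M (value rimᵢ) (value cycₙ) (value rimₚ) (value cycₚ) (pos t ℤ.* (M ℤ.+ M)) (spokeValue (toℕ i) 0) ⟩
    Λ ℤ.+ (value rimᵢ ℤ.+ value cycₙ ℤ.+ (value rimₚ ℤ.+ value cycₚ) ℤ.+ spokeValue (toℕ i) 0)
      ≡⟨ cong (λ z → Λ ℤ.+ z) (values-around i) ⟩
    Λ ℤ.+ sg (toℕ i) ℤ.* pos n ∎
    where
    open ≡-Reasoning
    rimᵢ rimₚ cycₙ cycₚ : Code
    rimᵢ = inj₂ (inj₁ i)
    rimₚ = inj₂ (inj₁ (prev i))
    cycₙ = inj₁ (inj₁ (next i))
    cycₚ = inj₁ (inj₁ (prev i))
    spokes : ℕ
    spokes = sum λ j → ℓ (inj₂ (inj₂ (i , j))) + ℓ (inj₁ (inj₂ j))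
    collect : ∀ M a b c d T e →
      (M ℤ.+ a ℤ.+ (M ℤ.+ b)) ℤ.+ (M ℤ.+ c ℤ.+ (M ℤ.+ d)) ℤ.+ (T ℤ.+ e) ≡
      (M ℤ.+ M) ℤ.+ (M ℤ.+ M) ℤ.+ T ℤ.+ (a ℤ.+ b ℤ.+ (c ℤ.+ d) ℤ.+ e)
    collect = ℤ-Solver.solve-∀

  ∑-cycleValue : ∑[< m ] cycleValue ≡ 0ℤ
  ∑-cycleValue = trans (cong (λ l → ∑[< l ] cycleValue) m≡h+h)
    (∑-antiperiodic {λ i → suc (half i)} (λ i → cong suc (half-periodic i)))

  -- Spokes to the first null vertex have `h`-periodic moduli under alternating signs. For the
  -- others a fixed sign and a block offset come out, leaving `∑-balanced`.
  ∑-spokeValue : ∀ j → ∑[< m ] (λ i → spokeValue i j) ≡ 0ℤ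
  ∑-spokeValue zero = trans (cong (λ l → ∑[< l ] (λ i → spokeValue i 0)) m≡h+h)
    (∑-antiperiodic {λ i → suc (h + suc i % h)} (λ i → cong (λ l → suc (h + l)) (suc-%-periodic i)))
  ∑-spokeValue (suc j) = begin
    ∑[< m ] (λ i → sg j ℤ.* (sg i ℤ.* pos (level r (balanced i))))
      ≡⟨ ∑-* m (sg j) (λ i → sg i ℤ.* pos (level r (balanced i))) ⟩
    sg j ℤ.* ∑[< m ] (λ i → sg i ℤ.* pos (level r (balanced i)))
      ≡⟨ cong (λ z → sg j ℤ.* z) balance ⟩
    sg j ℤ.* 0ℤ
      ≡⟨ ℤ.*-zeroʳ (sg j) ⟩
    0ℤ ∎
    where
    open ≡-Reasoning
    r : ℕ
    r = ⌊ j /2⌋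
    assoc : ∀ h R b → suc (h + (h + (h + (R + b)))) ≡ suc (h + (h + (h + R))) + b
    assoc = ℕ-Solver.solve-∀
    balance : ∑[< m ] (λ i → sg i ℤ.* pos (level r (balanced i))) ≡ 0ℤ
    balance = trans (∑-cong m λ i → cong (λ l → sg i ℤ.* pos l) (assoc h (r * suc m) (balanced i)))
      (trans (cong (λ l → ∑[< l ] (λ i → sg i ℤ.* (c ℤ.+ pos (balanced i)))) m≡6+4k) (∑-balanced k c))
      where c = pos (suc (h + (h + (h + r * suc m))))

  color-null-value : ∀ j → pos (color G labeling (m ↑ʳ j)) ≡ pos m ℤ.* (M ℤ.+ M)
  color-null-value j = begin
    pos (color G labeling (m ↑ʳ j))
      ≡⟨ cong pos (color-null j) ⟩
    pos (sum λ i → ℓ (inj₂ (inj₂ (i , j))) + ℓ (inj₁ (inj₁ i)))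
      ≡⟨ pos-sum _ (λ i → M ℤ.+ b i ℤ.+ (M ℤ.+ cycleValue i))
           (λ i → cong₂ ℤ._+_ (ℓ-value (inj₂ (inj₂ (i , j)))) (ℓ-value (inj₁ (inj₁ i)))) ⟩
    ∑[< m ] (λ i → M ℤ.+ b i ℤ.+ (M ℤ.+ cycleValue i))
      ≡⟨ ∑-cong m (λ i → regroup M (b i) (cycleValue i)) ⟩
    ∑[< m ] (λ i → M ℤ.+ M ℤ.+ (b i ℤ.+ cycleValue i))
      ≡⟨ trans (∑-+ m (λ _ → M ℤ.+ M) (λ i → b i ℤ.+ cycleValue i))
           (cong₂ ℤ._+_ (∑-const m (M ℤ.+ M)) (∑-+ m b cycleValue)) ⟩
    pos m ℤ.* (M ℤ.+ M) ℤ.+ (∑[< m ] b ℤ.+ ∑[< m ] cycleValue)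
      ≡⟨ cong₂ (λ x y → pos m ℤ.* (M ℤ.+ M) ℤ.+ (x ℤ.+ y)) (∑-spokeValue (toℕ j)) ∑-cycleValue ⟩
    pos m ℤ.* (M ℤ.+ M) ℤ.+ 0ℤ
      ≡⟨ ℤ.+-identityʳ _ ⟩
    pos m ℤ.* (M ℤ.+ M) ∎
    where
    open ≡-Reasoning
    b : ℕ → ℤ
    b i = spokeValue i (toℕ j)
    regroup : ∀ M b x → M ℤ.+ b ℤ.+ (M ℤ.+ x) ≡ M ℤ.+ M ℤ.+ (b ℤ.+ x)
    regroup = ℤ-Solver.solve-∀

  colorValue : Fin m ⊎ Fin t → ℤ
  colorValue (inj₁ i) = Λ ℤ.+ sg (toℕ i) ℤ.* pos n
  colorValue (inj₂ j) = pos m ℤ.* (M ℤ.+ M)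

  color-value : ∀ u → pos (color G labeling u) ≡ colorValue (splitAt m u)
  color-value u = by-side (splitAt m u) refl
    where
    by-side : ∀ x → splitAt m u ≡ x → pos (color G labeling u) ≡ colorValue x
    by-side (inj₁ i) eq = subst (λ u → pos (color G labeling u) ≡ _) (Fin.splitAt⁻¹-↑ˡ eq) (color-cycle-value i)
    by-side (inj₂ j) eq = subst (λ u → pos (color G labeling u) ≡ _) (Fin.splitAt⁻¹-↑ʳ eq) (color-null-value j)

  n<μ : n < μ
  n<μ = s≤s (≤-trans (≤-trans (m≤m+n n n) (n≤1+n _)) (m≤m+n h _))

  -- Λ and the color of a null vertex are both multiples of μ, so equality would make n a multiple
  -- of μ, against 0 < n < μ.
  cycle≢null : ∀ {δ} → IsSign δ → Λ ℤ.+ δ ℤ.* pos n ≢ pos m ℤ.* (M ℤ.+ M)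
  cycle≢null {δ} δ± eq = multiple ∣ q ∣ (trans (sym (∣sign*∣ δ± (pos n))) (trans (cong ∣_∣ δn≡Mq) (ℤ.abs-* M q)))
    where
    q : ℤ
    -- The difference of 2mμ and Λ, divided by μ.
    q = (pos m ℤ.+ pos m) ℤ.- (pos 4 ℤ.+ (pos t ℤ.+ pos t))
    isolate : ∀ M t x → x ≡ (M ℤ.+ M) ℤ.+ (M ℤ.+ M) ℤ.+ t ℤ.* (M ℤ.+ M) ℤ.+ x ℤ.-
              ((M ℤ.+ M) ℤ.+ (M ℤ.+ M) ℤ.+ t ℤ.* (M ℤ.+ M))
    isolate = ℤ-Solver.solve-∀
    factor : ∀ M m t → m ℤ.* (M ℤ.+ M) ℤ.- ((M ℤ.+ M) ℤ.+ (M ℤ.+ M) ℤ.+ t ℤ.* (M ℤ.+ M)) ≡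
             M ℤ.* ((m ℤ.+ m) ℤ.- (pos 4 ℤ.+ (t ℤ.+ t)))
    factor = ℤ-Solver.solve-∀
    δn≡Mq : δ ℤ.* pos n ≡ M ℤ.* q
    δn≡Mq = trans (isolate M (pos t) (δ ℤ.* pos n))
      (trans (cong (λ z → z ℤ.- Λ) eq) (factor M (pos m) (pos t)))
    multiple : ∀ a → n ≢ μ * a
    multiple zero    n≡0  = <⇒≢ 0<n (sym (trans n≡0 (*-zeroʳ μ)))
    multiple (suc a) n≡μa = <⇒≱ n<μ (subst (μ ≤_) (sym n≡μa) (m≤m*n μ (suc a)))

  -- The two colors differ by 2n up to sign, and n is positive.
  cycle≢cycle : ∀ {δ} → IsSign δ → Λ ℤ.+ δ ℤ.* pos n ≢ Λ ℤ.+ - δ ℤ.* pos n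
  cycle≢cycle {δ} δ± eq = <⇒≢ 0<n (sym (m+n≡0⇒m≡0 n (trans (sym (∣sign*∣ δ± (pos (n + n)))) (cong ∣_∣ double≡0))))
    where
    double : ∀ Λ δ n → δ ℤ.* (n ℤ.+ n) ≡ Λ ℤ.+ δ ℤ.* n ℤ.- (Λ ℤ.+ - δ ℤ.* n)
    double = ℤ-Solver.solve-∀
    double≡0 : δ ℤ.* pos (n + n) ≡ 0ℤ
    double≡0 = trans (double Λ δ (pos n)) (ℤ.i≡j⇒i-j≡0 eq)

  colorValue-proper : ∀ x y → JoinAdj (C m 3≤m) (O t) x y → colorValue x ≢ colorValue y
  colorValue-proper (inj₁ i) (inj₁ i′) (inj₁ ii′) eq = cycle≢cycle (sg-sign (toℕ i))
    (trans eq (cong (λ σ → Λ ℤ.+ σ ℤ.* pos n) (sg-Next ii′)))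
  colorValue-proper (inj₁ i) (inj₁ i′) (inj₂ i′i) eq = cycle≢cycle (sg-sign (toℕ i′))
    (trans (sym eq) (cong (λ σ → Λ ℤ.+ σ ℤ.* pos n) (sg-Next i′i)))
  colorValue-proper (inj₁ i) (inj₂ _) _ eq = cycle≢null (sg-sign (toℕ i)) eq
  colorValue-proper (inj₂ _) (inj₁ i) _ eq = cycle≢null (sg-sign (toℕ i)) (sym eq)

  isLocalTotalNeighborhoodAntimagic : IsLocalTotalNeighborhoodAntimagic G labeling
  isLocalTotalNeighborhoodAntimagic = record
    { noIsolated = noIsolated (subst (0 <_) (sym t≡1+2s) (s≤s z≤n))
    ; proper     = λ u v uv eq → colorValue-proper (splitAt m u) (splitAt m v) uv
                     (trans (sym (color-value u)) (trans (cong pos eq) (color-value v)))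
    }

  -- A triangle carrying all the colors.

  private
    0<t : 0 < t
    0<t = subst (0 <_) (sym t≡1+2s) (s≤s z≤n)

    -- Consecutive cycle vertices have opposite signs, so with a null vertex they show every color
    -- of the labeling; the same triangle gives the lower bound for all labelings.
    i₀ i₁ : Fin m
    i₀ = fromℕ< (≤-trans (s≤s z≤n) 3≤m)
    i₁ = fromℕ< (≤-trans (s≤s (s≤s z≤n)) 3≤m)

    toℕ-i₀ : toℕ i₀ ≡ 0
    toℕ-i₀ = Fin.toℕ-fromℕ< _

    toℕ-i₁ : toℕ i₁ ≡ 1
    toℕ-i₁ = Fin.toℕ-fromℕ< _

    u v w : Fin (m + t)
    u = i₀ ↑ˡ t
    v = i₁ ↑ˡ t
    w = m ↑ʳ fromℕ< 0<t

    uv : Adj G u v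
    uv = cycle-edge (inj₁ (inj₁ (trans toℕ-i₁ (cong suc (sym toℕ-i₀)))))

    uw : Adj G u w
    uw = spoke i₀ (fromℕ< 0<t)

    vw : Adj G v w
    vw = spoke i₁ (fromℕ< 0<t)

    same-color : ∀ {x y c} → colorValue (splitAt m x) ≡ c → colorValue (splitAt m y) ≡ c →
                 color G labeling x ≡ color G labeling y
    same-color {x} {y} eq eq′ = ℤ.+-injective
      (trans (color-value x) (trans (trans eq (sym eq′)) (sym (color-value y))))

    at-cycle-vertex : ∀ {y i δ} → splitAt m y ≡ inj₁ i → sg (toℕ i) ≡ δ → colorValue (splitAt m y) ≡ Λ ℤ.+ δ ℤ.* pos n
    at-cycle-vertex eq sg≡ = trans (cong colorValue eq) (cong (λ σ → Λ ℤ.+ σ ℤ.* pos n) sg≡)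

    at-null-vertex : ∀ {y j} → splitAt m y ≡ inj₂ j → colorValue (splitAt m y) ≡ pos m ℤ.* (M ℤ.+ M)
    at-null-vertex eq = cong colorValue eq

    cover : ∀ x → color G labeling x ≡ color G labeling u ⊎
                  color G labeling x ≡ color G labeling v ⊎
                  color G labeling x ≡ color G labeling w
    cover x = by-side (splitAt m x) refl
      where
      Covered : Set
      Covered = color G labeling x ≡ color G labeling u ⊎
                color G labeling x ≡ color G labeling v ⊎
                color G labeling x ≡ color G labeling w

      by-sign : ∀ {i δ} → splitAt m x ≡ inj₁ i → sg (toℕ i) ≡ δ → IsSign δ → Covered
      by-sign eq sg≡ (inj₁ refl) = inj₁ (same-color {x} {u}
        (at-cycle-vertex {x} eq sg≡) (at-cycle-vertex {u} (at-cycle i₀) (cong sg toℕ-i₀)))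
      by-sign eq sg≡ (inj₂ refl) = inj₂ (inj₁ (same-color {x} {v}
        (at-cycle-vertex {x} eq sg≡) (at-cycle-vertex {v} (at-cycle i₁) (cong sg toℕ-i₁))))

      by-side : ∀ y → splitAt m x ≡ y → Covered
      by-side (inj₁ i) eq = by-sign eq refl (sg-sign (toℕ i))
      by-side (inj₂ j) eq = inj₂ (inj₂ (same-color {x} {w}
        (at-null-vertex {x} eq) (at-null-vertex {w} (at-null (fromℕ< 0<t)))))

  χltna≡3 : χltna G ≡ 3
  χltna≡3 = record
    { attained = labeling , isLocalTotalNeighborhoodAntimagic ,
                 triangle⇒numColors≡3 isLocalTotalNeighborhoodAntimagic uv uw vw cover
    ; minimal  = λ f lab → triangle⇒3≤numColors lab uv uw vw
    }

theorem2p3 : ∀ (n s : ℕ) (1≤n : 1 ≤ n) (1≤s : 1 ≤ s) → χltna (C (4 * n + 2) (3≤4n+2 1≤n) ∨ O (2 * s + 1)) ≡ 3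
-- Writing n as k + 1 exhibits the six initial entries that `balanced` needs: 4n + 2 = 6 + 4k.
theorem2p3 (suc k) s 1≤n _ = Construction.χltna≡3 (suc k) k s (4 * suc k + 2) (2 * s + 1) 1≤n (3≤4n+2 1≤n)
  (m≡h+h (suc k)) (m≡6+4k k) (t≡1+2s s)
  where
  m≡h+h : ∀ n → 4 * n + 2 ≡ suc (n + n) + suc (n + n)
  m≡h+h = ℕ-Solver.solve-∀
  m≡6+4k : ∀ k → 4 * suc k + 2 ≡ 6 + k * 4
  m≡6+4k = ℕ-Solver.solve-∀
  t≡1+2s : ∀ s → 2 * s + 1 ≡ suc (s + s)
  t≡1+2s = ℕ-Solver.solve-∀
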